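{- Let $\lambda(n)=(-1)^{\Omega(n)}$ be Liouville's function, where $\Omega(n)$ is the total number of prime factors of $n$ counted with multiplicity. Then the sequence $(\lambda(n))_{n\geq 1}$ is not $k$-automatic for any integer $k\geq 2$. Consequently, for every prime $p>2$, the formal power series $\sum_{n=1}^\infty \lambda(n)X^n\in\mathbb{F}_p[[X]]$ (coefficients read in $\mathbb{F}_p$) is transcendental over $\mathbb{F}_p(X)$.
   Context: A sequence $(t(n))_{n\geq 1}$ taking values in a finite set is called $k$-automatic (for an integer $k\geq 2$) if its $k$-kernel, the set of sequences $\{(t(k^l n+r))_{n}: l\geq 0,\ 0\leq r<k^l\}$, is finite. -}

module Defs where

open import Data.Nat using (ℕ; zero; suc; _+_; _*_; _∸_; _^_; _<_; NonZero)
open import Data.Nat.Primality.Factorisation using (factorise; factors)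
open import Data.Integer as ℤ using (ℤ; +_; -_)
open import Data.Integer.Divisibility as ℤD using ()
open import Data.List using (List; []; _∷_; length)
open import Data.List.Relation.Unary.Any using (Any)
open import Data.Fin using (Fin; toℕ) renaming (zero to fzero; suc to fsuc)
open import Data.Product using (Σ; ∃; _×_)
open import Relation.Binary.PropositionalEquality using (_≡_)
open import Relation.Nullary using (¬_)

Ω : (n : ℕ) → .{{_ : NonZero n}} → ℕ
Ω n = length (factors (factorise n))

minusOnePow : ℕ → ℤ
minusOnePow zero    = + 1
minusOnePow (suc k) = - minusOnePow k

-- λ(n) = (-1)^Ω(n) for n ≥ 1; the value at 0 is irrelevant (set to 0),
-- sequences are indexed by n ≥ 1.
liouville : ℕ → ℤ
liouville zero    = + 0
liouville (suc m) = minusOnePow (Ω (suc m))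

-- k-automatic sequences (via the k-kernel), for sequences (t(n))_{n ≥ 1}
-- represented as t : ℕ → A whose value at 0 is ignored.

-- The kernel element with parameters l, r, re-indexed from 0:
-- i ↦ t(k^l (i+1) + r), i.e. n ↦ t(k^l n + r) for n ≥ 1.
kernelSeq : {A : Set} → ℕ → (ℕ → A) → ℕ → ℕ → (ℕ → A)
kernelSeq k t l r i = t (k ^ l * suc i + r)

KernelFinite : {A : Set} → ℕ → (ℕ → A) → Set
KernelFinite {A} k t =
  Σ (List (ℕ → A)) λ S →
    ∀ (l r : ℕ) → r < k ^ l →
      Any (λ s → ∀ i → s i ≡ kernelSeq k t l r i) S

Automatic : {A : Set} → ℕ → (ℕ → A) → Set
Automatic k t = KernelFinite k t

-- Formal power series with integer coefficients, read modulo p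

PS : Set
PS = ℕ → ℤ

sumTo : ℕ → (ℕ → ℤ) → ℤ
sumTo zero    f = f 0
sumTo (suc n) f = sumTo n f ℤ.+ f (suc n)

sumFin : (n : ℕ) → (Fin n → ℤ) → ℤ
sumFin zero    f = + 0
sumFin (suc n) f = f fzero ℤ.+ sumFin n (λ i → f (fsuc i))

_⊛_ : PS → PS → PS
(f ⊛ g) n = sumTo n (λ i → f i ℤ.* g (n ∸ i))

_^ₚ_ : PS → ℕ → PS
(f ^ₚ zero) zero    = + 1
(f ^ₚ zero) (suc n) = + 0
f ^ₚ suc j = f ⊛ (f ^ₚ j)

polyPS : List ℤ → PS
polyPS []       n       = + 0
polyPS (a ∷ as) zero    = a
polyPS (a ∷ as) (suc n) = polyPS as n

NonzeroMod : ℕ → List ℤ → Set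
NonzeroMod p P = ∃ λ n → ¬ ((+ p) ℤD.∣ polyPS P n)

-- f (read in F_p[[X]]) is algebraic over F_p(X): there are polynomials
-- P_0, …, P_d ∈ F_p[X], not all zero, with Σ_i P_i(X) f^i = 0 in F_p[[X]]
-- (denominators from F_p(X) cleared).
AlgebraicMod : ℕ → PS → Set
AlgebraicMod p f =
  Σ ℕ λ d → Σ (Fin (suc d) → List ℤ) λ P →
    (∃ λ i → NonzeroMod p (P i)) ×
    (∀ n → (+ p) ℤD.∣ sumFin (suc d) (λ i → (polyPS (P i) ⊛ (f ^ₚ toℕ i)) n))

TranscendentalMod : ℕ → PS → Set
TranscendentalMod p f = ¬ AlgebraicMod p f

{-# OPTIONS --safe #-}
module Submission where

-- Non-automaticity.  λ(p^l n + r) = λ(m^l) λ((m p)^l n + m^l r), so it suffices to treat a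
-- prime base q.  Write R_e = 1 + q + … + q^(e-1).  If the q-kernel is finite, pigeonholes give
--   (a) l and π ≥ 1 with λ(1 + V) = λ(1 + q^π V) whenever q^l ∣ V, V > 0;
--   (b) i and b ≥ 1 with λ(q^k R_i + r) = λ(q^k R_(i+T) + r) for all k, r < q^k and b ∣ T.
-- Take a prime P ≡ 1 (mod q^l) and u ≡ 1 (mod q^l) such that 1 + V = P u² is slightly larger
-- than a power of q.  Then λ(1 + V) = -1, and by (a) this persists for q^(π j) V in place of V.
-- For suitable j, T the quotient w = q^(k+i) R_T / (q^(π j) V) is an integer with leading
-- digits R_i, w = q^k R_i + r, while (1 + q^(π j) V) w = q^k R_(i+T) + r; so (b) gives
-- λ(1 + q^(π j) V) = 1, a contradiction.
--
-- Transcendence.  By Christol's argument an algebraic series f over F_p has a finite p-kernel: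
-- linear algebra yields a relation Σ a_i f^(p^i) = 0, applying the section operators
-- f ↦ Σ f(p n + r) X^n one may assume a_0 ≠ 0, and then all iterated sections of f lie in a
-- finite set of combinations of the f^(p^i).  For p > 2 the values ±1 are distinguished mod p.

-- With primes alone, a value -1 at a number that begins like a power of q and ends in 0...01 would
-- require primes of a progression in short intervals. Multiplying one fixed prime by squares keeps
-- the value -1, and its square multiples near x have gaps of order √x, far below the tolerance x /
-- q^i that i leading digits allow. One prime per modulus is then enough, and a cyclotomic value
-- supplies it. Repunits enter because R_(i+T) = q^i R_T + R_i: multiplying w by 1 + q^(π j) V adds
-- q^(k+i) R_T, that is, writes T more digits 1 in front of w, and (b) cannot see this change of
-- length. Moreover every positive integer divides some q^a R_s, which makes w integral. Three
-- periods must be aligned: T is a multiple of b and of s, and V moves up by multiples of π only, so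
-- 1 + V is sought near a power of q^π. For Christol's argument, the vanishing of an arbitrary
-- series is undecidable and series are never divided. So nonvanishing is carried as a witness
-- coefficient, and denominators are cleared throughout.

-- Complete multiplicativity and signs of Liouville's function.

module LiouvilleFunction where

  open import Defs
  open import Data.Nat using (ℕ; zero; suc; _+_; _*_; NonZero)
  open import Data.Nat.Properties using (*-zeroʳ; *-identityʳ; m*n≢0)
  open import Data.Nat.ListAction.Properties using (product-++)
  open import Data.Nat.Primality using (Prime; prime⇒nonZero)
  open import Data.Nat.Primality.Factorisation
  open import Data.Integer as ℤ using (ℤ; +_)
  import Data.Integer.Properties as ℤP
  open import Data.List using (_++_; length; _∷_; [])
  open import Data.List.Properties using (length-++)
  open import Data.List.Relation.Unary.All using (_∷_; [])
  open import Data.List.Relation.Unary.All.Properties using (++⁺)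
  open import Data.List.Relation.Binary.Permutation.Propositional.Properties using (↭-length)
  open import Data.Sum using (_⊎_; inj₁; inj₂)
  open import Relation.Binary.PropositionalEquality
  open PrimeFactorisation using (isFactorisation; factorsPrime)

  -- `Ω` is defined through the particular list that `factorise` returns. Uniqueness up to
  -- permutation frees it from this choice, so a product can be treated by concatenating factor
  -- lists.
  Ω-unique : ∀ n .{{_ : NonZero n}} (φ : PrimeFactorisation n) → Ω n ≡ length (factors φ)
  Ω-unique n φ = ↭-length (factorisationUnique (factorise n) φ)

  Ω-* : ∀ m n .{{_ : NonZero m}} .{{_ : NonZero n}} →
        Ω (m * n) {{m*n≢0 m n}} ≡ Ω m + Ω n
  Ω-* m n = trans (Ω-unique (m * n) {{m*n≢0 m n}} φ) (length-++ (factors μ))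
    where
    μ = factorise m
    ν = factorise n
    φ : PrimeFactorisation (m * n)
    φ = record
      { factors         = factors μ ++ factors ν
      ; isFactorisation = trans (cong₂ _*_ (isFactorisation μ) (isFactorisation ν))
                                (sym (product-++ (factors μ) (factors ν)))
      ; factorsPrime    = ++⁺ (factorsPrime μ) (factorsPrime ν)
      }

  Ω-prime : ∀ {p} (pr : Prime p) → Ω p {{prime⇒nonZero pr}} ≡ 1
  Ω-prime {p} pr = Ω-unique p {{prime⇒nonZero pr}} (record
    { factors         = p ∷ []
    ; isFactorisation = sym (*-identityʳ p)
    ; factorsPrime    = pr ∷ []
    })

  minusOnePow-+ : ∀ a b → minusOnePow (a + b) ≡ minusOnePow a ℤ.* minusOnePow b
  minusOnePow-+ zero    b = sym (ℤP.*-identityˡ _)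
  minusOnePow-+ (suc a) b =
    trans (cong ℤ.-_ (minusOnePow-+ a b)) (ℤP.neg-distribˡ-* (minusOnePow a) (minusOnePow b))

  liouville-* : ∀ m n → liouville (m * n) ≡ liouville m ℤ.* liouville n
  liouville-* zero    n       = refl
  liouville-* (suc m) zero    =
    trans (cong liouville (*-zeroʳ (suc m))) (sym (ℤP.*-zeroʳ (liouville (suc m))))
  liouville-* (suc m) (suc n) =
    trans (cong minusOnePow (Ω-* (suc m) (suc n))) (minusOnePow-+ (Ω (suc m)) (Ω (suc n)))

  liouville-prime : ∀ {p} → Prime p → liouville p ≡ ℤ.- + 1
  liouville-prime {suc p} pr = cong minusOnePow (Ω-prime pr)

  IsSign : ℤ → Set
  IsSign x = x ≡ + 1 ⊎ x ≡ ℤ.- + 1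

  IsSign-neg : ∀ {x} → IsSign x → IsSign (ℤ.- x)
  IsSign-neg (inj₁ refl) = inj₂ refl
  IsSign-neg (inj₂ refl) = inj₁ refl

  minusOnePow-sign : ∀ a → IsSign (minusOnePow a)
  minusOnePow-sign zero    = inj₁ refl
  minusOnePow-sign (suc a) = IsSign-neg (minusOnePow-sign a)

  liouville-sign : ∀ n .{{_ : NonZero n}} → IsSign (liouville n)
  liouville-sign (suc n) = minusOnePow-sign (Ω (suc n))

  IsSign-square : ∀ {x} → IsSign x → x ℤ.* x ≡ + 1
  IsSign-square (inj₁ refl) = refl
  IsSign-square (inj₂ refl) = refl

-- Frobenius and Fermat in commutative rings of prime characteristic.

module PrimeCharacteristic where

  open import Algebra.Bundles using (CommutativeRing)
  open import Data.Nat as ℕ using (ℕ; zero; suc; _<_; s≤s)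
  import Data.Nat.Properties as ℕP
  open import Data.Nat.Combinatorics using (_C_; nCn≡1; nCk+nC[k+1]≡[n+1]C[k+1]; nC1≡n)
  open import Data.Nat.Divisibility using (_∣_; divides; ∣⇒≤; m∣m*n)
  open import Data.Nat.Primality using (Prime; euclidsLemma; prime⇒nonZero)
  open import Data.Nat.Tactic.RingSolver using (solve-∀)
  open import Data.Fin as Fin using (Fin; fromℕ; inject₁)
  import Data.Fin.Properties as Fin
  open import Data.Sum using (inj₁; inj₂)
  open import Level using (0ℓ)
  open import Relation.Nullary using (contradiction)
  import Relation.Binary.PropositionalEquality as ≡
  open ≡ using (_≡_)

  [k+1]*[n+1]C[k+1] : ∀ n k → suc k ℕ.* (suc n C suc k) ≡ suc n ℕ.* (n C k)
  [k+1]*[n+1]C[k+1] zero    zero    = ≡.refl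
  [k+1]*[n+1]C[k+1] zero    (suc k) = ℕP.*-zeroʳ (suc (suc k))
  [k+1]*[n+1]C[k+1] (suc n) zero    = begin
    1 ℕ.* (suc (suc n) C 1)  ≡⟨ ℕP.*-identityˡ _ ⟩
    suc (suc n) C 1          ≡⟨ nC1≡n (suc (suc n)) ⟩
    suc (suc n)              ≡⟨ ℕP.*-identityʳ _ ⟨
    suc (suc n) ℕ.* 1        ∎
    where open ≡.≡-Reasoning
  [k+1]*[n+1]C[k+1] (suc n) (suc k) = begin
    suc (suc k) ℕ.* (suc (suc n) C suc (suc k))
      ≡⟨ ≡.cong (suc (suc k) ℕ.*_) (nCk+nC[k+1]≡[n+1]C[k+1] (suc n) (suc k)) ⟨
    suc (suc k) ℕ.* (u ℕ.+ v)
      ≡⟨ expand k u v ⟩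
    u ℕ.+ (suc k ℕ.* u ℕ.+ suc (suc k) ℕ.* v)
      ≡⟨ ≡.cong (u ℕ.+_) (≡.cong₂ ℕ._+_ ([k+1]*[n+1]C[k+1] n k) ([k+1]*[n+1]C[k+1] n (suc k))) ⟩
    u ℕ.+ (suc n ℕ.* (n C k) ℕ.+ suc n ℕ.* (n C suc k))
      ≡⟨ ≡.cong (u ℕ.+_) (ℕP.*-distribˡ-+ (suc n) (n C k) (n C suc k)) ⟨
    u ℕ.+ suc n ℕ.* ((n C k) ℕ.+ (n C suc k))
      ≡⟨ ≡.cong (λ z → u ℕ.+ suc n ℕ.* z) (nCk+nC[k+1]≡[n+1]C[k+1] n k) ⟩
    suc (suc n) ℕ.* u
      ∎
    where
    open ≡.≡-Reasoning
    u = suc n C suc k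
    v = suc n C suc (suc k)
    expand : ∀ k u v → suc (suc k) ℕ.* (u ℕ.+ v) ≡ u ℕ.+ (suc k ℕ.* u ℕ.+ suc (suc k) ℕ.* v)
    expand = solve-∀

  -- The absorption identity puts a factor p into (k+1) C(p, k+1), and p does not divide k+1 < p.
  prime∣pCk : ∀ {p} → Prime p → ∀ k → suc k < p → p ∣ (p C suc k)
  prime∣pCk {suc p} pr k k<p
    with euclidsLemma (suc k) (suc p C suc k) pr
           (≡.subst (suc p ∣_) (≡.sym ([k+1]*[n+1]C[k+1] p k)) (m∣m*n (p C k)))
  ... | inj₁ p∣1+k = contradiction (∣⇒≤ p∣1+k) (ℕP.<⇒≱ k<p)
  ... | inj₂ p∣C   = p∣C

  prime≡suc : ∀ {p} → Prime p → p ≡ suc (ℕ.pred p)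
  prime≡suc {p} pr = ≡.sym (ℕP.suc-pred p {{prime⇒nonZero pr}})

  -- Generic in the ring because both halves of the theorem use it: over the integers modulo p to
  -- find primes in a progression, over power series modulo p for Christol's argument.
  module PrimeChar (R : CommutativeRing 0ℓ 0ℓ) where

    open CommutativeRing R
    open import Algebra.Properties.Semiring.Exp semiring
    open import Algebra.Properties.Semiring.Mult semiring
    open import Algebra.Properties.Semiring.Sum semiring
      using (sum; sum-cong-≋; sum-init-last; sum-replicate; sum-replicate-zero)
    open import Algebra.Properties.CommutativeSemiring.Binomial commutativeSemiring
    open import Relation.Binary.Reasoning.Setoid setoid

    1#^ : ∀ n → 1# ^ n ≈ 1#
    1#^ zero    = refl
    1#^ (suc n) = trans (*-identityˡ _) (1#^ n)

    module _ {p} (pr : Prime p) (char : p × 1# ≈ 0#) where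

      p×≈0 : ∀ x → p × x ≈ 0#
      p×≈0 x = begin
        p × x          ≈⟨ ×-congʳ p (*-identityˡ x) ⟨
        p × (1# * x)   ≈⟨ ×-assoc-* p 1# x ⟨
        p × 1# * x     ≈⟨ *-congʳ char ⟩
        0# * x         ≈⟨ zeroˡ x ⟩
        0#             ∎

      p∣⇒×≈0 : ∀ {m} x → p ∣ m → m × x ≈ 0#
      p∣⇒×≈0 x (divides q ≡.refl) = begin
        (q ℕ.* p) × x  ≈⟨ ×-assocˡ x q p ⟨
        q × (p × x)    ≈⟨ ×-congʳ q (p×≈0 x) ⟩
        q × 0#         ≈⟨ sum-replicate q ⟨
        sum {q} (λ _ → 0#) ≈⟨ sum-replicate-zero q ⟩
        0#             ∎

      private
        -- Trading p for a literal successor lets the binomial sum split into its two end terms and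
        -- an interior in which p divides every coefficient.
        frobenius′ : ∀ n → p ≡ suc n → ∀ x y → (x + y) ^ suc n ≈ x ^ suc n + y ^ suc n
        frobenius′ n ≡.refl x y = begin
          (x + y) ^ suc n                       ≈⟨ theorem (suc n) x y ⟩
          t Fin.zero + sum (λ i → t (Fin.suc i))
            ≈⟨ +-cong t0 (sum-init-last (λ i → t (Fin.suc i))) ⟩
          y ^ suc n + (sum (λ i → t (Fin.suc (inject₁ i))) + t (Fin.suc (fromℕ n)))
            ≈⟨ +-congˡ (+-cong (trans (sum-cong-≋ {n} mid) (sum-replicate-zero n)) tn) ⟩
          y ^ suc n + (0# + x ^ suc n)          ≈⟨ +-congˡ (+-identityˡ _) ⟩
          y ^ suc n + x ^ suc n                 ≈⟨ +-comm _ _ ⟩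
          x ^ suc n + y ^ suc n                 ∎
          where
          t = binomialTerm x y (suc n)
          t0 : t Fin.zero ≈ y ^ suc n
          t0 = trans (×-homo-1 _) (*-identityˡ _)
          mid : ∀ i → t (Fin.suc (inject₁ i)) ≈ 0#
          mid i = p∣⇒×≈0 _ (prime∣pCk pr _ (s≤s (≡.subst (ℕ._< n) (≡.sym (Fin.toℕ-inject₁ i)) (Fin.toℕ<n i))))
          tn : t (Fin.suc (fromℕ n)) ≈ x ^ suc n
          tn rewrite Fin.toℕ-fromℕ n | nCn≡1 (suc n) | ℕP.n∸n≡0 n =
            trans (×-homo-1 _) (*-identityʳ _)

      frobenius : ∀ x y → (x + y) ^ p ≈ x ^ p + y ^ p
      frobenius x y = ≡.subst (λ m → (x + y) ^ m ≈ x ^ m + y ^ m) (≡.sym (prime≡suc pr)) (frobenius′ _ (prime≡suc pr) x y)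

      0#^p : 0# ^ p ≈ 0#
      0#^p = ≡.subst (λ m → 0# ^ m ≈ 0#) (≡.sym (prime≡suc pr)) (zeroˡ _)

      fermat : ∀ n → (n × 1#) ^ p ≈ n × 1#
      fermat zero    = 0#^p
      fermat (suc n) = begin
        (1# + n × 1#) ^ p       ≈⟨ frobenius 1# (n × 1#) ⟩
        1# ^ p + (n × 1#) ^ p   ≈⟨ +-cong (1#^ p) (fermat n) ⟩
        1# + n × 1#             ∎

-- Integer power series as a commutative ring modulo p.

module PowerSeries where

  open import Defs
  open import Algebra.Bundles using (CommutativeRing)
  open import Data.Nat as ℕ using (ℕ; zero; suc)
  open import Data.Integer using (ℤ; +_; -_; _+_; _-_; _*_)
  open import Data.Integer.Divisibility.Signed as Signed using (_∣_)
  import Data.Integer.Properties as ℤP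
  open import Data.Integer.Tactic.RingSolver using (solve-∀)
  open import Data.Product using (_,_)
  open import Function using (_∘_)
  open import Level using (0ℓ)
  open import Relation.Binary.PropositionalEquality

  -- Wrapped in a record so that both sides can be inferred from the type.
  record Congruent (p : ℕ) (x y : ℤ) : Set where
    constructor mod
    field diff : + p ∣ x - y
  open Congruent public

  module _ {p : ℕ} where

    private
      _≈_ = Congruent p

    reflexive : ∀ {x y} → x ≡ y → x ≈ y
    reflexive {x} refl = mod (Signed.divides (+ 0) (ℤP.i≡j⇒i-j≡0 {x} refl))

    ≈-sym : ∀ {x y} → x ≈ y → y ≈ x
    ≈-sym {x} {y} (mod d) = mod (subst (+ p ∣_) (lemma x y) (Signed.∣n⇒∣m*n (- (+ 1)) d))
      where lemma : ∀ x y → - (+ 1) * (x - y) ≡ y - x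
            lemma = solve-∀

    ≈-trans : ∀ {x y z} → x ≈ y → y ≈ z → x ≈ z
    ≈-trans {x} {y} {z} (mod d) (mod e) = mod (subst (+ p ∣_) (lemma x y z) (Signed.∣m∣n⇒∣m+n d e))
      where lemma : ∀ x y z → (x - y) + (y - z) ≡ x - z
            lemma = solve-∀

    +-cong-mod : ∀ {x y u v} → x ≈ y → u ≈ v → (x + u) ≈ (y + v)
    +-cong-mod {x} {y} {u} {v} (mod d) (mod e) =
      mod (subst (+ p ∣_) (lemma x y u v) (Signed.∣m∣n⇒∣m+n d e))
      where lemma : ∀ x y u v → (x - y) + (u - v) ≡ (x + u) - (y + v)
            lemma = solve-∀

    neg-cong-mod : ∀ {x y} → x ≈ y → (- x) ≈ (- y)
    neg-cong-mod {x} {y} (mod d) = mod (subst (+ p ∣_) (lemma x y) (Signed.∣n⇒∣m*n (- (+ 1)) d))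
      where lemma : ∀ x y → - (+ 1) * (x - y) ≡ (- x) - (- y)
            lemma = solve-∀

    *-cong-mod : ∀ {x y u v} → x ≈ y → u ≈ v → (x * u) ≈ (y * v)
    *-cong-mod {x} {y} {u} {v} (mod d) (mod e) =
      mod (subst (+ p ∣_) (lemma x y u v)
        (Signed.∣m∣n⇒∣m+n (Signed.∣n⇒∣m*n u d) (Signed.∣n⇒∣m*n y e)))
      where lemma : ∀ x y u v → u * (x - y) + y * (u - v) ≡ (x * u) - (y * v)
            lemma = solve-∀

  ℤmod : ℕ → CommutativeRing 0ℓ 0ℓ
  ℤmod p = record
    { Carrier = ℤ ; _≈_ = Congruent p ; _+_ = _+_ ; _*_ = _*_ ; -_ = -_ ; 0# = + 0 ; 1# = + 1
    ; isCommutativeRing = record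
      { isRing = record
        { +-isAbelianGroup = record
          { isGroup = record
            { isMonoid = record
              { isSemigroup = record
                { isMagma = record
                  { isEquivalence = record { refl = reflexive refl ; sym = ≈-sym ; trans = ≈-trans }
                  ; ∙-cong = +-cong-mod }
                ; assoc = λ x y z → reflexive (ℤP.+-assoc x y z) }
              ; identity = (λ x → reflexive (ℤP.+-identityˡ x)) , (λ x → reflexive (ℤP.+-identityʳ x)) }
            ; inverse = (λ x → reflexive (ℤP.+-inverseˡ x)) , (λ x → reflexive (ℤP.+-inverseʳ x))
            ; ⁻¹-cong = neg-cong-mod }
          ; comm = λ x y → reflexive (ℤP.+-comm x y) }
        ; *-cong = *-cong-mod
        ; *-assoc = λ x y z → reflexive (ℤP.*-assoc x y z)
        ; *-identity = (λ x → reflexive (ℤP.*-identityˡ x)) , (λ x → reflexive (ℤP.*-identityʳ x))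
        ; distrib = (λ x y z → reflexive (ℤP.*-distribˡ-+ x y z)) , (λ x y z → reflexive (ℤP.*-distribʳ-+ x y z)) }
      ; *-comm = λ x y → reflexive (ℤP.*-comm x y) } }

  tail : PS → PS
  tail f n = f (suc n)

  infixl 6 _⊕_
  _⊕_ : PS → PS → PS
  (f ⊕ g) n = f n + g n

  ⊖_ : PS → PS
  (⊖ f) n = - f n

  _·_ : ℤ → PS → PS
  (a · f) n = a * f n

  sumTo-front : ∀ n F → sumTo (suc n) F ≡ F 0 + sumTo n (F ∘ suc)
  sumTo-front zero    F = refl
  sumTo-front (suc n) F =
    trans (cong (_+ F (suc (suc n))) (sumTo-front n F)) (ℤP.+-assoc (F 0) _ _)

  -- The coefficient form of f = f(0) + X · `tail f`. With its mirror image `⊛-sucʳ` it reduces the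
  -- ring laws to inductions on the coefficient index, so double sums never have to be reindexed.
  ⊛-suc : ∀ f g n → (f ⊛ g) (suc n) ≡ f 0 * g (suc n) + (tail f ⊛ g) n
  ⊛-suc f g n = sumTo-front n (λ i → f i * g (suc n ℕ.∸ i))

  ⊛-sucʳ : ∀ f g n → (f ⊛ g) (suc n) ≡ f (suc n) * g 0 + (f ⊛ tail g) n
  ⊛-sucʳ f g zero    = ℤP.+-comm (f 0 * g 1) (f 1 * g 0)
  ⊛-sucʳ f g (suc n) = begin
    (f ⊛ g) (suc (suc n))                           ≡⟨ ⊛-suc f g (suc n) ⟩
    f 0 * g (2 ℕ.+ n) + (tail f ⊛ g) (suc n)        ≡⟨ cong (_+_ (f 0 * g (2 ℕ.+ n))) (⊛-sucʳ (tail f) g n) ⟩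
    f 0 * g (2 ℕ.+ n) + (f (2 ℕ.+ n) * g 0 + (tail f ⊛ tail g) n)
      ≡⟨ swap (f 0 * g (2 ℕ.+ n)) (f (2 ℕ.+ n) * g 0) _ ⟩
    f (2 ℕ.+ n) * g 0 + (f 0 * g (2 ℕ.+ n) + (tail f ⊛ tail g) n)
      ≡⟨ cong (_+_ (f (2 ℕ.+ n) * g 0)) (⊛-suc f (tail g) n) ⟨
    f (2 ℕ.+ n) * g 0 + (f ⊛ tail g) (suc n)        ∎
    where
    open ≡-Reasoning
    swap : ∀ x y z → x + (y + z) ≡ y + (x + z)
    swap = solve-∀

  ⊛-comm : ∀ f g n → (f ⊛ g) n ≡ (g ⊛ f) n
  ⊛-comm f g zero    = ℤP.*-comm (f 0) (g 0)
  ⊛-comm f g (suc n) = begin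
    (f ⊛ g) (suc n)                      ≡⟨ ⊛-suc f g n ⟩
    f 0 * g (suc n) + (tail f ⊛ g) n     ≡⟨ cong₂ _+_ (ℤP.*-comm (f 0) _) (⊛-comm (tail f) g n) ⟩
    g (suc n) * f 0 + (g ⊛ tail f) n     ≡⟨ ⊛-sucʳ g f n ⟨
    (g ⊛ f) (suc n)                      ∎
    where open ≡-Reasoning

  ⊛-distribʳ : ∀ h f g n → ((f ⊕ g) ⊛ h) n ≡ (f ⊛ h) n + (g ⊛ h) n
  ⊛-distribʳ h f g zero    = ℤP.*-distribʳ-+ (h 0) (f 0) (g 0)
  ⊛-distribʳ h f g (suc n) = begin
    ((f ⊕ g) ⊛ h) (suc n)
      ≡⟨ ⊛-suc (f ⊕ g) h n ⟩
    (f 0 + g 0) * h (suc n) + ((tail f ⊕ tail g) ⊛ h) n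
      ≡⟨ cong (_+_ ((f 0 + g 0) * h (suc n))) (⊛-distribʳ h (tail f) (tail g) n) ⟩
    (f 0 + g 0) * h (suc n) + ((tail f ⊛ h) n + (tail g ⊛ h) n)
      ≡⟨ regroup (f 0) (g 0) (h (suc n)) _ _ ⟩
    (f 0 * h (suc n) + (tail f ⊛ h) n) + (g 0 * h (suc n) + (tail g ⊛ h) n)
      ≡⟨ cong₂ _+_ (⊛-suc f h n) (⊛-suc g h n) ⟨
    (f ⊛ h) (suc n) + (g ⊛ h) (suc n) ∎
    where
    open ≡-Reasoning
    regroup : ∀ a b c x y → (a + b) * c + (x + y) ≡ (a * c + x) + (b * c + y)
    regroup = solve-∀

  ⊛-distribˡ : ∀ h f g n → (h ⊛ (f ⊕ g)) n ≡ (h ⊛ f) n + (h ⊛ g) n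
  ⊛-distribˡ h f g n =
    trans (⊛-comm h (f ⊕ g) n)
      (trans (⊛-distribʳ h f g n) (cong₂ _+_ (⊛-comm f h n) (⊛-comm g h n)))

  ·-⊛ : ∀ a f g n → ((a · f) ⊛ g) n ≡ a * (f ⊛ g) n
  ·-⊛ a f g zero    = ℤP.*-assoc a (f 0) (g 0)
  ·-⊛ a f g (suc n) = begin
    ((a · f) ⊛ g) (suc n)                        ≡⟨ ⊛-suc (a · f) g n ⟩
    a * f 0 * g (suc n) + ((a · tail f) ⊛ g) n   ≡⟨ cong₂ _+_ (ℤP.*-assoc a (f 0) _) (·-⊛ a (tail f) g n) ⟩
    a * (f 0 * g (suc n)) + a * (tail f ⊛ g) n   ≡⟨ ℤP.*-distribˡ-+ a (f 0 * g (suc n)) _ ⟨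
    a * (f 0 * g (suc n) + (tail f ⊛ g) n)       ≡⟨ cong (a *_) (⊛-suc f g n) ⟨
    a * (f ⊛ g) (suc n)                          ∎
    where open ≡-Reasoning

  -- The relation is a parameter because both equality and congruence modulo p are needed.
  sumTo-cong : (_~_ : ℤ → ℤ → Set) → (∀ {x y u v} → x ~ y → u ~ v → (x + u) ~ (y + v)) →
               ∀ n {F G : ℕ → ℤ} → (∀ i → F i ~ G i) → sumTo n F ~ sumTo n G
  sumTo-cong _~_ +-mono zero            F~G = F~G 0
  sumTo-cong _~_ +-mono (suc n) {F} {G} F~G =
    +-mono (sumTo-cong _~_ +-mono n {F} {G} F~G) (F~G (suc n))

  ⊛-congˡ-≡ : ∀ {f f′} → (∀ n → f n ≡ f′ n) → ∀ g n → (f ⊛ g) n ≡ (f′ ⊛ g) n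
  ⊛-congˡ-≡ f≡ g n = sumTo-cong _≡_ (cong₂ _+_) n (λ i → cong (_* g (n ℕ.∸ i)) (f≡ i))

  ⊛-assoc : ∀ f g h n → ((f ⊛ g) ⊛ h) n ≡ (f ⊛ (g ⊛ h)) n
  ⊛-assoc f g h zero    = ℤP.*-assoc (f 0) (g 0) (h 0)
  ⊛-assoc f g h (suc n) = begin
    ((f ⊛ g) ⊛ h) (suc n)
      ≡⟨ ⊛-suc (f ⊛ g) h n ⟩
    f 0 * g 0 * h (suc n) + (tail (f ⊛ g) ⊛ h) n
      ≡⟨ cong (_+_ (f 0 * g 0 * h (suc n))) tails ⟩
    f 0 * g 0 * h (suc n) + (f 0 * (tail g ⊛ h) n + (tail f ⊛ (g ⊛ h)) n)
      ≡⟨ regroup (f 0) (g 0) (h (suc n)) _ _ ⟩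
    f 0 * (g 0 * h (suc n) + (tail g ⊛ h) n) + (tail f ⊛ (g ⊛ h)) n
      ≡⟨ cong (λ z → f 0 * z + (tail f ⊛ (g ⊛ h)) n) (⊛-suc g h n) ⟨
    f 0 * (g ⊛ h) (suc n) + (tail f ⊛ (g ⊛ h)) n
      ≡⟨ ⊛-suc f (g ⊛ h) n ⟨
    (f ⊛ (g ⊛ h)) (suc n) ∎
    where
    open ≡-Reasoning
    regroup : ∀ a b c x y → a * b * c + (a * x + y) ≡ a * (b * c + x) + y
    regroup = solve-∀
    tails : (tail (f ⊛ g) ⊛ h) n ≡ f 0 * (tail g ⊛ h) n + (tail f ⊛ (g ⊛ h)) n
    tails = begin
      (tail (f ⊛ g) ⊛ h) n                              ≡⟨ ⊛-congˡ-≡ (⊛-suc f g) h n ⟩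
      (((f 0 · tail g) ⊕ (tail f ⊛ g)) ⊛ h) n           ≡⟨ ⊛-distribʳ h (f 0 · tail g) (tail f ⊛ g) n ⟩
      ((f 0 · tail g) ⊛ h) n + ((tail f ⊛ g) ⊛ h) n     ≡⟨ cong₂ _+_ (·-⊛ (f 0) (tail g) h n) (⊛-assoc (tail f) g h n) ⟩
      f 0 * (tail g ⊛ h) n + (tail f ⊛ (g ⊛ h)) n       ∎

  0ₚ 1ₚ : PS
  0ₚ _ = + 0
  1ₚ zero    = + 1
  1ₚ (suc _) = + 0

  ⊛-zeroˡ : ∀ f n → (0ₚ ⊛ f) n ≡ + 0
  ⊛-zeroˡ f zero    = refl
  ⊛-zeroˡ f (suc n) = trans (⊛-suc 0ₚ f n) (trans (ℤP.+-identityˡ _) (⊛-zeroˡ f n))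

  ⊛-identityˡ : ∀ f n → (1ₚ ⊛ f) n ≡ f n
  ⊛-identityˡ f zero    = ℤP.*-identityˡ (f 0)
  ⊛-identityˡ f (suc n) = begin
    (1ₚ ⊛ f) (suc n)                 ≡⟨ ⊛-suc 1ₚ f n ⟩
    + 1 * f (suc n) + (0ₚ ⊛ f) n     ≡⟨ cong₂ _+_ (ℤP.*-identityˡ (f (suc n))) (⊛-zeroˡ f n) ⟩
    f (suc n) + + 0                  ≡⟨ ℤP.+-identityʳ _ ⟩
    f (suc n)                        ∎
    where open ≡-Reasoning

  record PSCongruent (p : ℕ) (f g : PS) : Set where
    constructor pw
    field at : ∀ n → Congruent p (f n) (g n)
  open PSCongruent public

  PSmod : ℕ → CommutativeRing 0ℓ 0ℓ
  PSmod p = record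
    { Carrier = PS ; _≈_ = PSCongruent p ; _+_ = _⊕_ ; _*_ = _⊛_ ; -_ = ⊖_ ; 0# = 0ₚ ; 1# = 1ₚ
    ; isCommutativeRing = record
      { isRing = record
        { +-isAbelianGroup = record
          { isGroup = record
            { isMonoid = record
              { isSemigroup = record
                { isMagma = record
                  { isEquivalence = record
                    { refl = exact (λ _ → refl)
                    ; sym = λ e → pw λ n → ≈-sym (at e n)
                    ; trans = λ d e → pw λ n → ≈-trans (at d n) (at e n) }
                  ; ∙-cong = λ d e → pw λ n → +-cong-mod (at d n) (at e n) }
                ; assoc = λ f g h → exact λ n → ℤP.+-assoc (f n) (g n) (h n) }
              ; identity = (λ f → exact λ n → ℤP.+-identityˡ (f n)) , (λ f → exact λ n → ℤP.+-identityʳ (f n)) }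
            ; inverse = (λ f → exact λ n → ℤP.+-inverseˡ (f n)) , (λ f → exact λ n → ℤP.+-inverseʳ (f n))
            ; ⁻¹-cong = λ e → pw λ n → neg-cong-mod (at e n) }
          ; comm = λ f g → exact λ n → ℤP.+-comm (f n) (g n) }
        ; *-cong = λ d e → pw λ n → sumTo-cong (Congruent p) +-cong-mod n
                     (λ i → *-cong-mod (at d i) (at e (n ℕ.∸ i)))
        ; *-assoc = λ f g h → exact (⊛-assoc f g h)
        ; *-identity = (λ f → exact (⊛-identityˡ f)) , (λ f → exact λ n → trans (⊛-comm f 1ₚ n) (⊛-identityˡ f n))
        ; distrib = (λ h f g → exact (⊛-distribˡ h f g)) , (λ h f g → exact (⊛-distribʳ h f g)) }
      ; *-comm = λ f g → exact (⊛-comm f g) } }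
    where
    exact : ∀ {f g : PS} → (∀ n → f n ≡ g n) → PSCongruent p f g
    exact f≡g = pw λ n → reflexive (f≡g n)

-- A prime congruent to 1 modulo a given power of a prime q.

module PrimesInProgressions where

  open PrimeCharacteristic
  open PowerSeries using (mod; diff; ℤmod; reflexive)
  open import Algebra.Bundles using (CommutativeRing)
  open import Data.Nat using (ℕ; zero; suc; _+_; _*_; _∸_; _^_; _≤_; _<_; z≤n; s≤s; s≤s⁻¹; pred; >-nonZero)
  open import Data.Nat.Properties
  open import Data.Nat.Divisibility
  open import Data.Nat.Coprimality using (Coprime; coprime-Bézout)
  open import Data.Nat.GCD using (module Bézout)
  open import Data.Nat.Primality
  open import Data.Nat.Primality.Factorisation using (factorise)
  open import Data.Nat.Tactic.RingSolver using (solve-∀)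
  import Data.Integer.Tactic.RingSolver as ℤSolver
  open import Data.Integer as ℤ using (ℤ; +_; ∣_∣)
  import Data.Integer.Properties as ℤP
  import Data.Integer.Divisibility.Signed as Signed
  open import Data.List using ([]; _∷_)
  open import Data.List.Relation.Unary.All using (_∷_)
  open import Data.Nat.ListAction using (product)
  open import Data.Product using (∃; _×_; _,_)
  open import Data.Sum using (inj₁; inj₂)
  open import Relation.Nullary using (¬_; contradiction; yes; no)
  open import Relation.Binary.PropositionalEquality as ≡ using (_≡_; refl; cong; subst; module ≡-Reasoning)

  prime-divisor : ∀ n → 1 < n → ∃ λ p → Prime p × p ∣ n
  prime-divisor n 1<n with factorise n {{>-nonZero (<-trans z<s 1<n)}}
    where open import Data.Nat using (z<s)
  ... | record { factors = [] ; isFactorisation = n≡1 } = contradiction 1<n (<-irrefl (≡.sym n≡1))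
  ... | record { factors = p ∷ ps ; isFactorisation = refl ; factorsPrime = pr ∷ _ } =
    p , pr , m∣m*n (product ps)

  -- The sum 1 + y + ... + y^(n-1). For y = q^(q^l) and n = q it is the value at q of the cyclotomic
  -- polynomial of order q^(l+1).
  geometric : ℕ → ℕ → ℕ
  geometric y zero    = 0
  geometric y (suc n) = 1 + y * geometric y n

  geometric-sum : ∀ y n → y * geometric y n + 1 ≡ y ^ n + geometric y n
  geometric-sum y zero    = cong (_+ 1) (*-zeroʳ y)
  geometric-sum y (suc n) = begin
    y * (1 + y * g) + 1          ≡⟨ lhs y g ⟩
    y * (y * g + 1) + 1          ≡⟨ cong (λ z → y * z + 1) (geometric-sum y n) ⟩
    y * (y ^ n + g) + 1          ≡⟨ rhs y (y ^ n) g ⟩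
    y * y ^ n + (1 + y * g)      ∎
    where
    open ≡-Reasoning
    g = geometric y n
    lhs : ∀ y g → y * (1 + y * g) + 1 ≡ y * (y * g + 1) + 1
    lhs = solve-∀
    rhs : ∀ y x g → y * (x + g) + 1 ≡ y * x + (1 + y * g)
    rhs = solve-∀

  coprime-prime : ∀ {q m} → Prime q → ¬ q ∣ m → Coprime m q
  coprime-prime pq q∤m (d∣m , d∣q) with prime⇒irreducible pq d∣q
  ... | inj₁ d≡1  = d≡1
  ... | inj₂ refl = contradiction d∣m q∤m

  prime∣^ : ∀ {p} m n → Prime p → p ∣ m ^ n → p ∣ m
  prime∣^ m zero    pr p∣ = contradiction (subst Prime (∣1⇒≡1 p∣) pr) ¬prime[1]
  prime∣^ m (suc n) pr p∣ with euclidsLemma m (m ^ n) pr p∣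
  ... | inj₁ p∣m = p∣m
  ... | inj₂ p∣m^n = prime∣^ m n pr p∣m^n

  module _ {p : ℕ} where

    open CommutativeRing (ℤmod p) using (_≈_; 1#; 0#; semiring; *-congˡ; *-congʳ; +-congˡ; setoid)
      renaming (*-identityˡ to ⊗-identityˡ; *-identityʳ to ⊗-identityʳ; refl to ≈-refl; sym to ≈-sym; trans to ≈-trans)
    open import Algebra.Properties.Semiring.Exp semiring using () renaming (_^_ to _↑_; ^-assocʳ to ↑-*; ^-congˡ to ↑-congˡ)
    open import Algebra.Properties.Semiring.Mult semiring using () renaming (_×_ to _•_)
    open PrimeChar (ℤmod p) using (fermat; 1#^)

    pos-↑ : ∀ m n → (+ m) ↑ n ≡ + (m ^ n)
    pos-↑ m zero    = refl
    pos-↑ m (suc n) = ≡.trans (cong (+ m ℤ.*_) (pos-↑ m n)) (≡.sym (ℤP.pos-* m (m ^ n)))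

    ×1≡+ : ∀ n → n • 1# ≡ + n
    ×1≡+ zero    = refl
    ×1≡+ (suc n) = cong (ℤ._+_ (+ 1)) (×1≡+ n)

    ∣⇒≈0 : ∀ {n} → p ∣ n → + n ≈ 0#
    ∣⇒≈0 {n} p∣n = mod (Signed.∣ᵤ⇒∣ (subst (λ z → p ∣ ∣ z ∣) (≡.sym (ℤP.+-identityʳ (+ n))) p∣n))

    ≈0⇒∣ : ∀ {n} → + n ≈ 0# → p ∣ n
    ≈0⇒∣ {n} (mod d) = subst (λ z → p ∣ ∣ z ∣) (ℤP.+-identityʳ (+ n)) (Signed.∣⇒∣ᵤ d)

    char-ℤmod : p • 1# ≈ 0#
    char-ℤmod = ≈-trans (reflexive (×1≡+ p)) (∣⇒≈0 ∣-refl)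

    private
      power-unit : ∀ {z} x m → z ↑ m ≈ 1# → z ↑ (x * m) ≈ 1#
      power-unit {z} x m zᵐ = begin
        z ↑ (x * m)   ≡⟨ cong (z ↑_) (*-comm x m) ⟩
        z ↑ (m * x)   ≈⟨ ↑-* z m x ⟨
        (z ↑ m) ↑ x   ≈⟨ ↑-congˡ x zᵐ ⟩
        1# ↑ x        ≈⟨ 1#^ x ⟩
        1#            ∎
        where open import Relation.Binary.Reasoning.Setoid setoid

      coprime-powers : ∀ {z} x m y n → 1 + y * n ≡ x * m → z ↑ m ≈ 1# → z ↑ n ≈ 1# → z ≈ 1#
      coprime-powers {z} x m y n eq zᵐ zⁿ = begin
        z                         ≈⟨ ⊗-identityʳ z ⟨
        z ℤ.* 1#                  ≈⟨ *-congˡ {z} (power-unit y n zⁿ) ⟨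
        z ↑ (1 + y * n)           ≡⟨ cong (z ↑_) eq ⟩
        z ↑ (x * m)               ≈⟨ power-unit x m zᵐ ⟩
        1#                        ∎
        where open import Relation.Binary.Reasoning.Setoid setoid

    -- Bézout over ℕ gives 1 + y n = x m or the same with m and n exchanged. In the first case z = z
    -- (z^n)^y = (z^m)^x = 1, with no inverse of z involved.
    coprime-roots : ∀ {m n z} → Coprime m n → z ↑ m ≈ 1# → z ↑ n ≈ 1# → z ≈ 1#
    coprime-roots {m} {n} c zᵐ zⁿ with coprime-Bézout c
    ... | Bézout.+- x y eq = coprime-powers x m y n eq zᵐ zⁿ
    ... | Bézout.-+ x y eq = coprime-powers y n x m eq zⁿ zᵐ

    module _ (pr : Prime p) where

      -- Euclid's lemma cancels one factor n from n^p ≡ n.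
      fermat-unit : ∀ {n} → ¬ p ∣ n → (+ n) ↑ pred p ≈ 1#
      fermat-unit {n} p∤n = mod (Signed.∣ᵤ⇒∣ p∣z-1)
        where
        z = (+ n) ↑ pred p
        eq : (+ n) ↑ p ≈ + n
        eq = subst (λ x → x ↑ p ≈ x) (×1≡+ n) (fermat pr char-ℤmod n)
        p∣n*[z-1] : p ∣ n * ∣ z ℤ.- + 1 ∣
        p∣n*[z-1] = subst (p ∣_) (≡.trans (cong ∣_∣ factor) (ℤP.abs-* (+ n) (z ℤ.- + 1))) (Signed.∣⇒∣ᵤ (diff eq))
          where
          open ≡-Reasoning
          factor : (+ n) ↑ p ℤ.- + n ≡ + n ℤ.* (z ℤ.- + 1)
          factor = begin
            (+ n) ↑ p ℤ.- + n              ≡⟨ cong (λ m → (+ n) ↑ m ℤ.- + n) (prime≡suc pr) ⟩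
            + n ℤ.* z ℤ.- + n              ≡⟨ factor-out (+ n) z ⟩
            + n ℤ.* (z ℤ.- + 1)            ∎
            where
            factor-out : ∀ x z → x ℤ.* z ℤ.- x ≡ x ℤ.* (z ℤ.- + 1)
            factor-out = ℤSolver.solve-∀
        p∣z-1 : p ∣ ∣ z ℤ.- + 1 ∣
        p∣z-1 with euclidsLemma n ∣ z ℤ.- + 1 ∣ pr p∣n*[z-1]
        ... | inj₁ p∣n = contradiction p∣n p∤n
        ... | inj₂ p∣  = p∣

    geometric-at-1 : ∀ {y} n → + y ≈ 1# → + geometric y n ≈ + n
    geometric-at-1 zero    y≈1 = ≈-refl
    geometric-at-1 {y} (suc n) y≈1 = begin
      + 1 ℤ.+ + (y * geometric y n)       ≡⟨ cong (ℤ._+_ (+ 1)) (ℤP.pos-* y (geometric y n)) ⟩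
      + 1 ℤ.+ + y ℤ.* + geometric y n     ≈⟨ +-congˡ {+ 1} (*-congʳ {+ geometric y n} y≈1) ⟩
      + 1 ℤ.+ + 1 ℤ.* + geometric y n     ≈⟨ +-congˡ {+ 1} (⊗-identityˡ (+ geometric y n)) ⟩
      + 1 ℤ.+ + geometric y n             ≈⟨ +-congˡ {+ 1} (geometric-at-1 n y≈1) ⟩
      + 1 ℤ.+ + n                         ∎
      where open import Relation.Binary.Reasoning.Setoid setoid

    geometric-root : ∀ {y} n → p ∣ geometric y n → (+ y) ↑ n ≈ 1#
    geometric-root {y} n p∣g = begin
      (+ y) ↑ n                             ≡⟨ pos-↑ y n ⟩
      + (y ^ n)                             ≡⟨ ℤP.+-identityʳ _ ⟨
      + (y ^ n) ℤ.+ + 0                     ≈⟨ +-congˡ {+ (y ^ n)} g≈0 ⟨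
      + (y ^ n) ℤ.+ + g                     ≡⟨ ℤP.pos-+ (y ^ n) g ⟨
      + (y ^ n + g)                         ≡⟨ cong +_ (geometric-sum y n) ⟨
      + (y * g + 1)                         ≡⟨ ℤP.pos-+ (y * g) 1 ⟩
      + (y * g) ℤ.+ + 1                     ≈⟨ CommutativeRing.+-congʳ (ℤmod p) {+ 1} (∣⇒≈0 (∣n⇒∣m*n y p∣g)) ⟩
      1#                                    ∎
      where
      open import Relation.Binary.Reasoning.Setoid setoid
      g = geometric y n
      g≈0 : + g ≈ 0#
      g≈0 = ∣⇒≈0 p∣g

    -- y = q^(q^l) has order exactly q modulo p, so q^(l+1) divides p - 1: as long as
    -- q^j does with j ≤ l, the cofactor m is a multiple of q, for otherwise the order of y
    -- would divide both q and m.
    order-divides : ∀ {q} → Prime q → ∀ l → Prime p → p ∣ geometric (q ^ (q ^ l)) q →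
                    ∀ j → j ≤ suc l → q ^ j ∣ pred p
    order-divides pq l pr p∣g zero    _ = 1∣ _
    order-divides {q} pq l pr p∣g (suc j) 1+j≤1+l
      with order-divides pq l pr p∣g j (≤-trans (n≤1+n j) 1+j≤1+l)
    ... | divides m eq with q ∣? m
    ...   | yes (divides m′ refl) = divides m′ (≡.trans eq (*-assoc m′ q (q ^ j)))
    ...   | no  q∤m = contradiction p∣y p∤y
      where
      y = q ^ (q ^ l)
      p∤y : ¬ p ∣ y
      p∤y p∣y = ¬prime[1] (subst Prime (∣1⇒≡1 (∣m+n∣m⇒∣n (p∣+1 q pq p∣g) (∣m⇒∣m*n _ p∣y))) pr)
        where
        p∣+1 : ∀ q → Prime q → p ∣ geometric y q → p ∣ y * geometric y (pred q) + 1
        p∣+1 zero    pq _  = contradiction pq ¬prime[0]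
        p∣+1 (suc q) _  p∣ = subst (p ∣_) (+-comm 1 (y * geometric y q)) p∣
      p∤q : ¬ p ∣ q
      p∤q p∣q = p∤y (∣-trans p∣q (subst (λ e → q ∣ q ^ e) (suc-pred (q ^ l) {{m^n≢0 q l {{prime⇒nonZero pq}}}}) (m∣m*n _)))
      x = + q
      l≡ : l ≡ j + (l ∸ j)
      l≡ = ≡.sym (m+[n∸m]≡n (s≤s⁻¹ 1+j≤1+l))
      exponent : q ^ l * m ≡ pred p * q ^ (l ∸ j)
      exponent = begin
        q ^ l * m                      ≡⟨ cong (λ e → q ^ e * m) l≡ ⟩
        q ^ (j + (l ∸ j)) * m          ≡⟨ cong (_* m) (^-distribˡ-+-* q j (l ∸ j)) ⟩
        q ^ j * q ^ (l ∸ j) * m        ≡⟨ rearrange (q ^ j) (q ^ (l ∸ j)) m ⟩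
        m * q ^ j * q ^ (l ∸ j)        ≡⟨ cong (_* q ^ (l ∸ j)) eq ⟨
        pred p * q ^ (l ∸ j)           ∎
        where
        open ≡-Reasoning
        rearrange : ∀ a b c → a * b * c ≡ c * a * b
        rearrange = solve-∀
      yᵐ : (+ y) ↑ m ≈ 1#
      yᵐ = begin
        (+ y) ↑ m                          ≡⟨ cong (_↑ m) (pos-↑ q (q ^ l)) ⟨
        (x ↑ (q ^ l)) ↑ m                  ≈⟨ ↑-* x (q ^ l) m ⟩
        x ↑ (q ^ l * m)                    ≡⟨ cong (x ↑_) exponent ⟩
        x ↑ (pred p * q ^ (l ∸ j))         ≈⟨ ↑-* x (pred p) (q ^ (l ∸ j)) ⟨
        (x ↑ pred p) ↑ (q ^ (l ∸ j))       ≈⟨ ↑-congˡ (q ^ (l ∸ j)) (fermat-unit pr p∤q) ⟩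
        1# ↑ (q ^ (l ∸ j))                 ≈⟨ 1#^ (q ^ (l ∸ j)) ⟩
        1#                                 ∎
        where open import Relation.Binary.Reasoning.Setoid setoid
      y≈1 : + y ≈ 1#
      y≈1 = coprime-roots (coprime-prime pq q∤m) yᵐ (geometric-root q p∣g)
      p∣y : p ∣ y
      p∣y = contradiction (≈0⇒∣ (≈-trans (≈-sym (geometric-at-1 q y≈1)) (∣⇒≈0 p∣g))) p∤q

  -- For exponent l+1, any prime divisor of the cyclotomic value of order q^(l+1) at q will do,
  -- since q^(l+1) divides p - 1 for each of them. This special case of Dirichlet's theorem is all
  -- that is required, because squares supply the remaining freedom.
  prime≡1mod-prime-power : ∀ {q} → Prime q → ∀ l → ∃ λ p → Prime p × ∃ λ c → p ≡ 1 + q ^ l * c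
  prime≡1mod-prime-power {q} pq zero = 2 , prime[2] , 1 , refl
  prime≡1mod-prime-power {q} pq (suc l)
    with prime-divisor (geometric (q ^ (q ^ l)) q) 1<g
    where
    instance _ = prime⇒nonZero pq
    1<g : 1 < geometric (q ^ (q ^ l)) q
    1<g = 1<geometric q (nonTrivial⇒n>1 q {{prime⇒nonTrivial pq}}) (m^n>0 q (q ^ l))
      where
      open import Data.Nat using (nonTrivial⇒n>1)
      1<geometric : ∀ {y} n → 1 < n → 0 < y → 1 < geometric y n
      1<geometric (suc (suc n)) _ 0<y = s≤s (*-mono-≤ 0<y (s≤s z≤n))
      1<geometric (suc zero) (s≤s ()) _
  ... | p , pr , p∣g with order-divides pq l pr p∣g (suc l) ≤-refl
  ...   | divides c eq = p , pr , c , (begin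
    p                     ≡⟨ prime≡suc pr ⟩
    1 + pred p            ≡⟨ cong suc (≡.trans eq (*-comm c _)) ⟩
    1 + q ^ suc l * c     ∎)
    where open ≡-Reasoning

-- Non-automaticity in a prime base.

module PrimeBase where

  open import Defs
  open LiouvilleFunction
  open PrimesInProgressions using (prime≡1mod-prime-power)
  open import Data.Nat
  open import Data.Nat.Properties
  open import Data.Nat.Divisibility
  open import Data.Nat.DivMod
  open import Data.Nat.Primality using (Prime; prime⇒nonZero; prime⇒nonTrivial)
  open import Data.Nat.Tactic.RingSolver using (solve-∀)
  open import Data.Integer as ℤ using (ℤ)
  import Data.Integer.Properties as ℤP
  open import Data.Fin as Fin using (Fin; toℕ)
  import Data.Fin.Properties as Fin
  open import Data.List as List using (length)
  open import Data.List.Relation.Unary.Any as Any using (Any)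
  open import Data.List.Relation.Unary.Any.Properties using (lookup-index)
  open import Data.Product using (∃; ∃₂; _×_; _,_; proj₁; proj₂)
  open import Data.Sum using (inj₁; inj₂)
  open import Data.Empty using (⊥)
  open import Function using (it)
  open import Relation.Nullary using (¬_; contradiction; yes; no)
  open import Relation.Binary.PropositionalEquality

  module Repunits (q : ℕ) (2≤q : 2 ≤ q) where

    private instance
      q≢0 : NonZero q
      q≢0 = >-nonZero (≤-trans (s≤s z≤n) 2≤q)
      pred-q≢0 : NonZero (pred q)
      pred-q≢0 = >-nonZero (s≤s⁻¹ (subst (2 ≤_) (sym (suc-pred q)) 2≤q))

    rep : ℕ → ℕ
    rep zero    = 0
    rep (suc e) = suc (q * rep e)

    -- Concatenation of digit strings: t ones followed by i ones.
    rep-+ : ∀ i t → rep (i + t) ≡ q ^ i * rep t + rep i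
    rep-+ zero    t = sym (trans (+-identityʳ _) (*-identityˡ _))
    rep-+ (suc i) t = trans (cong (λ z → suc (q * z)) (rep-+ i t)) (lemma q (q ^ i) (rep t) (rep i))
      where lemma : ∀ q x y z → suc (q * (x * y + z)) ≡ q * x * y + suc (q * z)
            lemma = solve-∀

    rep-closed : ∀ i → pred q * rep i + 1 ≡ q ^ i
    rep-closed zero    = cong (_+ 1) (*-zeroʳ (pred q))
    rep-closed (suc i) = begin
      pred q * suc (q * rep i) + 1       ≡⟨ lemma (pred q) q (rep i) ⟩
      suc (pred q) + q * (pred q * rep i) ≡⟨ cong (_+ q * (pred q * rep i)) (suc-pred q) ⟩
      q + q * (pred q * rep i)           ≡⟨ lemma′ q (pred q * rep i) ⟩
      q * (pred q * rep i + 1)           ≡⟨ cong (q *_) (rep-closed i) ⟩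
      q * q ^ i                          ∎
      where
      open ≡-Reasoning
      lemma : ∀ p q r → p * suc (q * r) + 1 ≡ suc p + q * (p * r)
      lemma = solve-∀
      lemma′ : ∀ q x → q + q * x ≡ q * (x + 1)
      lemma′ = solve-∀

    rep-∣ : ∀ m s → rep s ∣ rep (m * s)
    rep-∣ zero    s = rep s ∣0
    rep-∣ (suc m) s = subst (rep s ∣_) (sym (rep-+ s (m * s)))
      (∣m∣n⇒∣m+n (∣n⇒∣m*n (q ^ s) (rep-∣ m s)) ∣-refl)

    %≡⇒∣ : ∀ m n d .{{_ : NonZero d}} → (m + n) % d ≡ n % d → d ∣ m
    %≡⇒∣ m n d eq = ∣m+n∣m⇒∣n {m = n / d * d} (divides ((m + n) / d) (+-cancelˡ-≡ (n % d) _ _ (begin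
      n % d + (n / d * d + m)        ≡⟨ +-assoc (n % d) (n / d * d) m ⟨
      n % d + n / d * d + m          ≡⟨ cong (_+ m) (m≡m%n+[m/n]*n n d) ⟨
      n + m                          ≡⟨ +-comm n m ⟩
      m + n                          ≡⟨ m≡m%n+[m/n]*n (m + n) d ⟩
      (m + n) % d + (m + n) / d * d  ≡⟨ cong (_+ (m + n) / d * d) eq ⟩
      n % d + (m + n) / d * d        ∎))) (n∣m*n (n / d))
      where open ≡-Reasoning

    -- Among d + 1 repunits two agree modulo d, and their difference is `rep y` - `rep x` = q^x ·
    -- `rep (y - x)`.
    divides-rep : ∀ d .{{_ : NonZero d}} → ∃₂ λ a s → NonZero s × d ∣ q ^ a * rep s
    divides-rep d with Fin.pigeonhole (n<1+n d) (λ x → rep (toℕ x) mod d)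
    ... | x , y , x<y , eq = toℕ x , toℕ y ∸ toℕ x , >-nonZero (m<n⇒0<n∸m x<y) ,
      %≡⇒∣ (q ^ toℕ x * rep (toℕ y ∸ toℕ x)) (rep (toℕ x)) d (begin
        (q ^ toℕ x * rep (toℕ y ∸ toℕ x) + rep (toℕ x)) % d  ≡⟨ cong (_% d) (rep-+ (toℕ x) _) ⟨
        rep (toℕ x + (toℕ y ∸ toℕ x)) % d                    ≡⟨ cong (λ z → rep z % d) (m+[n∸m]≡n (<⇒≤ x<y)) ⟩
        rep (toℕ y) % d                                      ≡⟨ remainder (rep (toℕ y)) ⟨
        toℕ (rep (toℕ y) mod d)                              ≡⟨ cong toℕ eq ⟨
        toℕ (rep (toℕ x) mod d)                              ≡⟨ remainder (rep (toℕ x)) ⟩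
        rep (toℕ x) % d                                      ∎)
      where
      open ≡-Reasoning
      remainder : ∀ n → toℕ (n mod d) ≡ n % d
      remainder n = Fin.toℕ-fromℕ< (m%n<n n d)

    module _ {i t V ε} (V≡ : V ≡ q ^ t + ε) (ε-small : (ε + 1) * q ^ i ≤ q ^ t) where

      private
        Q = pred q
        scaled : ∀ x e → Q * (x * rep e) + x ≡ x * q ^ e
        scaled x e = trans (lemma Q x (rep e)) (cong (x *_) (rep-closed e))
          where lemma : ∀ a x r → a * (x * r) + x ≡ x * (a * r + 1)
                lemma = solve-∀

      -- Together with the upper bound this says that q^i · `rep t` / V has integer part `rep i`.
      -- After multiplication by q - 1, where (q - 1) · `rep e` = q^e - 1, the claim becomes (ε + 1)
      -- q^i ≤ V, so the closeness of V to q^t decides it. The upper bound uses only V ≥ q^t.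
      rep-window-lower : V * rep i ≤ q ^ i * rep t
      rep-window-lower = *-cancelˡ-≤ Q (+-cancelʳ-≤ (V + q ^ i) _ _ (begin
        Q * (V * rep i) + (V + q ^ i)              ≡⟨ +-assoc _ V (q ^ i) ⟨
        Q * (V * rep i) + V + q ^ i                ≡⟨ cong (_+ q ^ i) (scaled V i) ⟩
        V * q ^ i + q ^ i                          ≡⟨ cong (λ v → v * q ^ i + q ^ i) V≡ ⟩
        (q ^ t + ε) * q ^ i + q ^ i                ≡⟨ lemma (q ^ t) ε (q ^ i) ⟩
        q ^ i * q ^ t + (ε + 1) * q ^ i            ≤⟨ +-monoʳ-≤ (q ^ i * q ^ t) ε-small ⟩
        q ^ i * q ^ t + q ^ t                      ≤⟨ +-monoʳ-≤ (q ^ i * q ^ t) (m≤m+n (q ^ t) ε) ⟩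
        q ^ i * q ^ t + (q ^ t + ε)                ≡⟨ cong (q ^ i * q ^ t +_) V≡ ⟨
        q ^ i * q ^ t + V                          ≡⟨ cong (_+ V) (scaled (q ^ i) t) ⟨
        Q * (q ^ i * rep t) + q ^ i + V            ≡⟨ lemma′ _ (q ^ i) V ⟩
        Q * (q ^ i * rep t) + (V + q ^ i)          ∎))
        where
        open ≤-Reasoning
        lemma : ∀ a b c → (a + b) * c + c ≡ c * a + (b + 1) * c
        lemma = solve-∀
        lemma′ : ∀ a b c → a + b + c ≡ a + (c + b)
        lemma′ = solve-∀

      rep-window-upper : q ^ i * rep t < V * (rep i + 1)
      rep-window-upper = *-cancelˡ-< Q _ _ (begin-strict
        Q * (q ^ i * rep t)             <⟨ m<m+n _ (m^n>0 q i) ⟩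
        Q * (q ^ i * rep t) + q ^ i     ≡⟨ scaled (q ^ i) t ⟩
        q ^ i * q ^ t                   ≤⟨ *-monoʳ-≤ (q ^ i) (subst (q ^ t ≤_) (sym V≡) (m≤m+n (q ^ t) ε)) ⟩
        q ^ i * V                       ≡⟨ *-comm (q ^ i) V ⟩
        V * q ^ i                       ≡⟨ scaled V i ⟨
        Q * (V * rep i) + V             ≤⟨ +-monoʳ-≤ (Q * (V * rep i)) (m≤n*m V Q) ⟩
        Q * (V * rep i) + Q * V         ≡⟨ lemma Q V (rep i) ⟩
        Q * (V * (rep i + 1))           ∎)
        where
        open ≤-Reasoning
        lemma : ∀ a v r → a * (v * r) + a * v ≡ a * (v * (r + 1))
        lemma = solve-∀

    n≤q^n : ∀ n → n ≤ q ^ n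
    n≤q^n zero    = z≤n
    n≤q^n (suc n) = begin
      suc n            ≤⟨ +-mono-≤ (m^n>0 q n) (n≤q^n n) ⟩
      q ^ n + q ^ n    ≡⟨ cong (q ^ n +_) (+-identityʳ _) ⟨
      2 * q ^ n        ≤⟨ *-monoˡ-≤ (q ^ n) 2≤q ⟩
      q * q ^ n        ∎
      where open ≤-Reasoning

    crossing : ∀ (φ : ℕ → ℕ) N n → φ 0 ≤ N → N < φ n → ∃ λ v → φ v ≤ N × N < φ (suc v)
    crossing φ N zero    φ0≤N N<φ0 = contradiction φ0≤N (<⇒≱ N<φ0)
    crossing φ N (suc n) φ0≤N N<φ with φ n ≤? N
    ... | yes φn≤N = n , φn≤N , N<φ
    ... | no  φn≰N = crossing φ N n φ0≤N (≰⇒> φn≰N)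

    -- Consecutive values of P u² near q^(2h) are only O(q^h) apart.
    square-multiple-near-power : ∀ P A c π i .{{_ : NonZero A}} .{{_ : NonZero π}} → P ≡ 1 + A * c →
      ∃₂ λ u x → ∃₂ λ τ ε → P * (u * u) ≡ 1 + A * x × A * x ≡ q ^ (π * τ) + ε × (ε + 1) * q ^ i ≤ q ^ (π * τ)
    square-multiple-near-power P A c π i P≡ =
      u , c * (u * u) + (2 * suc v + A * (suc v * suc v)) , X + X , ε , Pu²≡ , Ax≡ , ε-small
      where
      X h N : ℕ
      -- The gap at the crossing is at most 3 P A² q^h. `X` is this coefficient times the precision
      -- q^i, so X ≤ q^h bounds the gap times q^i by q^(2h). The exponent of `N` is 2h, which makes
      -- `N` the square of q^h, and is a multiple of π.
      X = 3 * P * (A * A) * q ^ i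
      h = π * X
      N = q ^ (π * (X + X))

      N≡ : N ≡ q ^ h * q ^ h
      N≡ = trans (cong (q ^_) (*-distribˡ-+ π X X)) (^-distribˡ-+-* q h h)

      1≤P : 1 ≤ P
      1≤P = subst (1 ≤_) (sym P≡) (s≤s z≤n)
      1≤A : 1 ≤ A
      1≤A = >-nonZero⁻¹ A
      1≤q^h : 1 ≤ q ^ h
      1≤q^h = m^n>0 q h

      X≤q^h : X ≤ q ^ h
      X≤q^h = ≤-trans (m≤n*m X π) (n≤q^n h)

      φ : ℕ → ℕ
      φ v = P * ((1 + A * v) * (1 + A * v))

      φ0≤N : φ 0 ≤ N
      φ0≤N = begin
        P * ((1 + A * 0) * (1 + A * 0))  ≡⟨ cong (λ z → P * ((1 + z) * (1 + z))) (*-zeroʳ A) ⟩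
        P * 1                            ≤⟨ *-mono-≤ (m≤n*m P 3) (*-mono-≤ (*-mono-≤ 1≤A 1≤A) (m^n>0 q i)) ⟩
        3 * P * (A * A * q ^ i)          ≡⟨ *-assoc (3 * P) (A * A) (q ^ i) ⟨
        X                                ≤⟨ X≤q^h ⟩
        q ^ h                            ≤⟨ m≤m*n (q ^ h) (q ^ h) {{>-nonZero 1≤q^h}} ⟩
        q ^ h * q ^ h                    ≡⟨ N≡ ⟨
        N                                ∎
        where open ≤-Reasoning

      N<φN : N < φ N
      N<φN = begin-strict
        N                                <⟨ n<1+n N ⟩
        1 + N                            ≤⟨ +-monoʳ-≤ 1 (m≤n*m N A) ⟩
        1 + A * N                        ≤⟨ m≤m*n (1 + A * N) (1 + A * N) ⟩
        (1 + A * N) * (1 + A * N)        ≤⟨ m≤n*m _ P {{>-nonZero 1≤P}} ⟩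
        φ N                              ∎
        where open ≤-Reasoning

      cross = crossing φ N N φ0≤N N<φN
      v = proj₁ cross
      u₀ u ε : ℕ
      u₀ = 1 + A * v
      u = 1 + A * suc v
      ε = φ (suc v) ∸ suc N

      φ≡ : suc N + ε ≡ φ (suc v)
      φ≡ = m+[n∸m]≡n (proj₂ (proj₂ cross))

      Pu²≡ : P * (u * u) ≡ 1 + A * (c * (u * u) + (2 * suc v + A * (suc v * suc v)))
      Pu²≡ = trans (cong (_* (u * u)) P≡) (lemma A c (suc v))
        where lemma : ∀ A c w → (1 + A * c) * ((1 + A * w) * (1 + A * w))
                      ≡ 1 + A * (c * ((1 + A * w) * (1 + A * w)) + (2 * w + A * (w * w)))
              lemma = solve-∀

      Ax≡ : A * (c * (u * u) + (2 * suc v + A * (suc v * suc v))) ≡ N + ε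
      Ax≡ = suc-injective (trans (sym Pu²≡) (sym φ≡))

      -- Since u₀² ≤ P u₀² ≤ q^(2h), the term 2 A u₀ in the step to the next multiple is of order
      -- q^h only.
      u₀≤q^h : u₀ ≤ q ^ h
      u₀≤q^h = ≮⇒≥ λ q^h<u₀ → <⇒≱ (*-mono-< q^h<u₀ q^h<u₀)
        (subst (u₀ * u₀ ≤_) N≡ (≤-trans (m≤n*m _ P {{>-nonZero 1≤P}}) (proj₁ (proj₂ cross))))

      gap : ε + 1 ≤ P * (2 * A * u₀ + A * A)
      gap = +-cancelˡ-≤ (φ v) _ _ (begin
        φ v + (ε + 1)                          ≤⟨ +-monoˡ-≤ (ε + 1) (proj₁ (proj₂ cross)) ⟩
        N + (ε + 1)                            ≡⟨ shift N ε ⟩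
        suc N + ε                              ≡⟨ φ≡ ⟩
        φ (suc v)                              ≡⟨ step P A v ⟩
        φ v + P * (2 * A * u₀ + A * A)         ∎)
        where
        open ≤-Reasoning
        shift : ∀ N ε → N + (ε + 1) ≡ suc N + ε
        shift = solve-∀
        step : ∀ P A v → P * ((1 + A * (1 + v)) * (1 + A * (1 + v)))
               ≡ P * ((1 + A * v) * (1 + A * v)) + P * (2 * A * (1 + A * v) + A * A)
        step = solve-∀

      ε-small : (ε + 1) * q ^ i ≤ N
      ε-small = begin
        (ε + 1) * q ^ i                                          ≤⟨ *-monoˡ-≤ (q ^ i) gap ⟩
        P * (2 * A * u₀ + A * A) * q ^ i                         ≤⟨ *-monoˡ-≤ (q ^ i) (*-monoʳ-≤ P (+-mono-≤
                                                                      (*-mono-≤ (*-monoʳ-≤ 2 (m≤m*n A A)) u₀≤q^h)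
                                                                      (m≤m*n (A * A) (q ^ h) {{>-nonZero 1≤q^h}}))) ⟩
        P * (2 * (A * A) * q ^ h + A * A * q ^ h) * q ^ i        ≡⟨ collect P (A * A) (q ^ h) (q ^ i) ⟩
        X * q ^ h                                                ≤⟨ *-monoˡ-≤ (q ^ h) X≤q^h ⟩
        q ^ h * q ^ h                                            ≡⟨ N≡ ⟨
        N                                                        ∎
        where
        open ≤-Reasoning
        collect : ∀ P a x y → P * (2 * a * x + a * x) * y ≡ 3 * P * a * y * x
        collect = solve-∀

  -- Total on ℤ because the sequences listed in a finite cover are arbitrary outside the kernel
  -- sequences they match. It separates values only when they are known to be ±1.
  sign : ℤ → Fin 2
  sign x with x ℤP.≟ ℤ.+ 1
  ... | yes _ = Fin.zero
  ... | no  _ = Fin.suc Fin.zero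

  sign-injective : ∀ {x y} → IsSign x → IsSign y → sign x ≡ sign y → x ≡ y
  sign-injective (inj₁ refl) (inj₁ refl) _ = refl
  sign-injective (inj₂ refl) (inj₂ refl) _ = refl
  sign-injective (inj₁ refl) (inj₂ refl) ()
  sign-injective (inj₂ refl) (inj₁ refl) ()

  IsSign⇒≢- : ∀ {x} → IsSign x → x ≢ ℤ.- ℤ.+ 1 ℤ.* x
  IsSign⇒≢- (inj₁ refl) ()
  IsSign⇒≢- (inj₂ refl) ()

  -- The contradiction derived from a finite q-kernel.

  module FiniteKernel (t : ℕ → ℤ)
                      (t-* : ∀ m n → t (m * n) ≡ t m ℤ.* t n)
                      (t-sign : ∀ n .{{_ : NonZero n}} → IsSign (t n))
                      (t-prime : ∀ {p} → Prime p → t p ≡ ℤ.- ℤ.+ 1)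
                      {q : ℕ} (pq : Prime q) (finite : KernelFinite q t) where

    2≤q : 2 ≤ q
    2≤q = nonTrivial⇒n>1 q {{prime⇒nonTrivial pq}}

    open Repunits q 2≤q

    private
      instance
        q≢0 : NonZero q
        q≢0 = prime⇒nonZero pq

      S = proj₁ finite
      M = length S

      index : ∀ l r → r < q ^ l → Fin M
      index l r r< = Any.index (proj₂ finite l r r<)

      value : Fin M → ℕ → ℤ
      value = List.lookup S

      value-index : ∀ l r r< n → value (index l r r<) n ≡ t (q ^ l * suc n + r)
      value-index l r r< = lookup-index (proj₂ finite l r r<)

    -- Of the levels 1, ..., M + 1 two share the same list entry at residue 1, and π is their
    -- difference. Levels start at 1 because residue 1 must lie below q^l.
    dilation : ∃₂ λ l π → NonZero π ×
               ∀ x → NonZero x → t (1 + q ^ l * x) ≡ t (1 + q ^ π * (q ^ l * x))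
    dilation with Fin.pigeonhole (n<1+n M) (λ x → index (suc (toℕ x)) 1 (1<q^ (toℕ x)))
      where
      1<q^ : ∀ e → 1 < q ^ suc e
      1<q^ e = ≤-trans 2≤q (m≤m*n q (q ^ e) {{m^n≢0 q e}})
    ... | i , j , i<j , eq = suc (toℕ i) , toℕ j ∸ toℕ i , >-nonZero (m<n⇒0<n∸m i<j) , same
      where
      open ≡-Reasoning
      power : ∀ i j → i ≤ j → q ^ suc j ≡ q ^ (j ∸ i) * q ^ suc i
      power i j i≤j = trans (cong (q ^_) (sym (trans (+-suc (j ∸ i) i) (cong suc (m∸n+n≡m i≤j)))))
                            (^-distribˡ-+-* q (j ∸ i) (suc i))
      same : ∀ x → NonZero x → t (1 + q ^ suc (toℕ i) * x)
                             ≡ t (1 + q ^ (toℕ j ∸ toℕ i) * (q ^ suc (toℕ i) * x))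
      same (suc n) _ = begin
        t (1 + q ^ suc (toℕ i) * suc n)       ≡⟨ cong t (+-comm 1 _) ⟩
        t (q ^ suc (toℕ i) * suc n + 1)       ≡⟨ value-index (suc (toℕ i)) 1 _ n ⟨
        value (index (suc (toℕ i)) 1 _) n             ≡⟨ cong (λ c → value c n) eq ⟩
        value (index (suc (toℕ j)) 1 _) n             ≡⟨ value-index (suc (toℕ j)) 1 _ n ⟩
        t (q ^ suc (toℕ j) * suc n + 1)       ≡⟨ cong t (+-comm _ 1) ⟩
        t (1 + q ^ suc (toℕ j) * suc n)       ≡⟨ cong (λ z → t (1 + z * suc n)) (power (toℕ i) (toℕ j) (<⇒≤ i<j)) ⟩
        t (1 + q ^ (toℕ j ∸ toℕ i) * q ^ suc (toℕ i) * suc n)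
          ≡⟨ cong (λ z → t (1 + z)) (*-assoc (q ^ (toℕ j ∸ toℕ i)) _ _) ⟩
        t (1 + q ^ (toℕ j ∸ toℕ i) * (q ^ suc (toℕ i) * suc n)) ∎

    infix 4 _~_
    -- The Myhill-Nerode equivalence of digit strings: every common suffix, with leading zeros
    -- allowed, leads to equal values.
    _~_ : ℕ → ℕ → Set
    m ~ n = ∀ k r → r < q ^ k → t (q ^ k * m + r) ≡ t (q ^ k * n + r)

    -- The appended digit 1 is absorbed into the suffix, which then has k + 1 digits and starts with
    -- 1.
    ~-step : ∀ {m n} → m ~ n → suc (q * m) ~ suc (q * n)
    ~-step {m} {n} m~n k r r< = begin
      t (q ^ k * suc (q * m) + r)       ≡⟨ cong t (lemma q (q ^ k) m r) ⟩
      t (q ^ suc k * m + (q ^ k + r))   ≡⟨ m~n (suc k) (q ^ k + r) small ⟩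
      t (q ^ suc k * n + (q ^ k + r))   ≡⟨ cong t (lemma q (q ^ k) n r) ⟨
      t (q ^ k * suc (q * n) + r)       ∎
      where
      open ≡-Reasoning
      lemma : ∀ q x m r → x * suc (q * m) + r ≡ q * x * m + (x + r)
      lemma = solve-∀
      small : q ^ k + r < q ^ suc k
      small = <-≤-trans (+-monoʳ-< (q ^ k) r<)
        (≤-trans (≤-reflexive (cong (q ^ k +_) (sym (+-identityʳ (q ^ k))))) (*-monoˡ-≤ (q ^ k) 2≤q))

    ~-shift : ∀ e {i j} → rep i ~ rep j → rep (e + i) ~ rep (e + j)
    ~-shift zero    i~j = i~j
    ~-shift (suc e) i~j = ~-step (~-shift e i~j)

    ~-iterate : ∀ m {i b} → rep i ~ rep (b + i) → rep i ~ rep (m * b + i)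
    ~-iterate zero            i~ k r r< = refl
    ~-iterate (suc m) {i} {b} i~ k r r< =
      trans (~-iterate m i~ k r r<)
        (trans (~-shift (m * b) i~ k r r<) (cong (λ z → t (q ^ k * rep z + r)) lemma))
      where
      lemma : m * b + (b + i) ≡ suc m * b + i
      lemma = trans (sym (+-assoc (m * b) b i)) (cong (_+ i) (+-comm (m * b) b))

    -- The class of n + 1 under `_~_` is determined by the signs of the M listed sequences at n.
    -- Hence there are at most 2^M classes of positive numbers, and two of 2^M + 1 positive repunits
    -- are equivalent.
    equivalent-repunits : ∃₂ λ i b → NonZero i × NonZero b × rep i ~ rep (b + i)
    equivalent-repunits with Fin.pigeonhole (n<1+n (2 ^ M)) (λ x → Fin.funToFin (row (toℕ x)))
      where
      row : ℕ → Fin M → Fin 2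
      -- Kernel sequences are indexed from 0, so the repunit `suc (q * rep e)` sits at index
      -- `q * rep e`.
      row e c = sign (value c (q * rep e))
    ... | x , y , x<y , eq = suc (toℕ x) , toℕ y ∸ toℕ x , _ , >-nonZero (m<n⇒0<n∸m x<y) , λ k r r< →
      trans (sign-injective (positive k _ r) (positive k _ r) (same-sign k r r<))
        (cong (λ e → t (q ^ k * rep e + r))
          (sym (trans (+-suc (toℕ y ∸ toℕ x) (toℕ x)) (cong suc (m∸n+n≡m (<⇒≤ x<y))))))
      where
      positive : ∀ k n r → IsSign (t (q ^ k * suc n + r))
      positive k n r = t-sign _ {{>-nonZero (≤-trans (*-mono-≤ (m^n>0 q k) (s≤s (z≤n {n}))) (m≤m+n _ r))}}
      same-row : ∀ c → sign (value c (q * rep (toℕ x))) ≡ sign (value c (q * rep (toℕ y)))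
      same-row c = trans (sym (Fin.finToFun-funToFin (λ c → sign (value c (q * rep (toℕ x)))) c))
        (trans (cong (λ z → Fin.finToFun z c) eq)
               (Fin.finToFun-funToFin (λ c → sign (value c (q * rep (toℕ y)))) c))
      same-sign : ∀ k r → r < q ^ k →
        sign (t (q ^ k * rep (suc (toℕ x)) + r)) ≡ sign (t (q ^ k * rep (suc (toℕ y)) + r))
      same-sign k r r< = subst₂ (λ a b → sign a ≡ sign b)
        (value-index k r r< (q * rep (toℕ x))) (value-index k r r< (q * rep (toℕ y))) (same-row (index k r r<))

    dilations : ∀ l π → (∀ x → NonZero x → t (1 + q ^ l * x) ≡ t (1 + q ^ π * (q ^ l * x))) →
                ∀ j x → NonZero x → t (1 + q ^ l * x) ≡ t (1 + q ^ (π * j) * (q ^ l * x))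
    dilations l π dil zero    x x≢0 = cong (λ z → t (1 + z))
      (sym (trans (cong (λ e → q ^ e * (q ^ l * x)) (*-zeroʳ π)) (*-identityˡ _)))
    dilations l π dil (suc j) x x≢0 = begin
      t (1 + q ^ l * x)                               ≡⟨ dilations l π dil j x x≢0 ⟩
      t (1 + q ^ (π * j) * (q ^ l * x))               ≡⟨ cong (λ z → t (1 + z)) (swap (q ^ (π * j)) (q ^ l) x) ⟩
      t (1 + q ^ l * (q ^ (π * j) * x))               ≡⟨ dil _ (m*n≢0 (q ^ (π * j)) x {{m^n≢0 q (π * j)}} {{x≢0}}) ⟩
      t (1 + q ^ π * (q ^ l * (q ^ (π * j) * x)))     ≡⟨ cong (λ z → t (1 + z)) (swap′ (q ^ π) (q ^ l) (q ^ (π * j)) x) ⟩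
      t (1 + q ^ π * q ^ (π * j) * (q ^ l * x))       ≡⟨ cong (λ z → t (1 + z * (q ^ l * x))) (^-distribˡ-+-* q π (π * j)) ⟨
      t (1 + q ^ (π + π * j) * (q ^ l * x))           ≡⟨ cong (λ e → t (1 + q ^ e * (q ^ l * x))) (*-suc π j) ⟨
      t (1 + q ^ (π * suc j) * (q ^ l * x))           ∎
      where
      open ≡-Reasoning
      swap : ∀ a b x → a * (b * x) ≡ b * (a * x)
      swap = solve-∀
      swap′ : ∀ a b c x → a * (b * (c * x)) ≡ a * c * (b * x)
      swap′ = solve-∀

    -- With w = q^i z, multiplication by 1 + V turns q^k rep i + r into q^k rep (T + i) + r.
    equivalent-repunits-exclude : ∀ i T j V₀ ε a z .{{_ : NonZero i}} .{{_ : NonZero V₀}} →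
      rep i ~ rep (T + i) → t (1 + q ^ j * V₀) ≡ ℤ.- ℤ.+ 1 →
      q ^ j * V₀ ≡ q ^ T + ε → (ε + 1) * q ^ i ≤ q ^ T → q ^ a * rep T ≡ z * V₀ → ⊥
    equivalent-repunits-exclude i T j V₀ ε a z i~ λ[1+V] V≡ ε-small z≡ =
      IsSign⇒≢- (t-sign w {{w≢0}}) λw
      where
      δ V k w : ℕ
      δ = q ^ j
      V = δ * V₀
      -- For this `k` one has V w = q^(k+i) · `rep T`, so w / q^k equals q^i · `rep T` / V, and the
      -- window bounds identify its integer part as `rep i`.
      k = a + j
      w = q ^ i * z

      V₀w≡ : V₀ * w ≡ q ^ i * (q ^ a * rep T)
      V₀w≡ = trans (lemma V₀ (q ^ i) z) (cong (q ^ i *_) (sym z≡))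
        where lemma : ∀ v x z → v * (x * z) ≡ x * (z * v)
              lemma = solve-∀

      q^k≡ : q ^ k ≡ q ^ a * δ
      q^k≡ = ^-distribˡ-+-* q a j

      w-lower : q ^ k * rep i ≤ w
      w-lower = *-cancelˡ-≤ V₀ (begin
        V₀ * (q ^ k * rep i)              ≡⟨ cong (λ y → V₀ * (y * rep i)) q^k≡ ⟩
        V₀ * (q ^ a * δ * rep i)          ≡⟨ lemma V₀ (q ^ a) δ (rep i) ⟩
        q ^ a * (V * rep i)               ≤⟨ *-monoʳ-≤ (q ^ a) (rep-window-lower {i} {T} V≡ ε-small) ⟩
        q ^ a * (q ^ i * rep T)           ≡⟨ swap (q ^ a) (q ^ i) (rep T) ⟩
        q ^ i * (q ^ a * rep T)           ≡⟨ V₀w≡ ⟨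
        V₀ * w                            ∎)
        where
        open ≤-Reasoning
        lemma : ∀ v a d r → v * (a * d * r) ≡ a * (d * v * r)
        lemma = solve-∀
        swap : ∀ a b c → a * (b * c) ≡ b * (a * c)
        swap = solve-∀

      w-upper : w < q ^ k * rep i + q ^ k
      w-upper = *-cancelˡ-< V₀ _ _ (begin-strict
        V₀ * w                            ≡⟨ V₀w≡ ⟩
        q ^ i * (q ^ a * rep T)           ≡⟨ swap (q ^ i) (q ^ a) (rep T) ⟩
        q ^ a * (q ^ i * rep T)           <⟨ *-monoʳ-< (q ^ a) {{m^n≢0 q a}} (rep-window-upper {i} {T} V≡ ε-small) ⟩
        q ^ a * (V * (rep i + 1))         ≡⟨ lemma (q ^ a) δ V₀ (rep i) ⟩
        V₀ * (q ^ a * δ * rep i + q ^ a * δ) ≡⟨ cong (λ y → V₀ * (y * rep i + y)) q^k≡ ⟨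
        V₀ * (q ^ k * rep i + q ^ k)      ∎)
        where
        open ≤-Reasoning
        lemma : ∀ a d v r → a * (d * v * (r + 1)) ≡ v * (a * d * r + a * d)
        lemma = solve-∀
        swap : ∀ a b c → a * (b * c) ≡ b * (a * c)
        swap = solve-∀

      r : ℕ
      r = w ∸ q ^ k * rep i

      w≡ : q ^ k * rep i + r ≡ w
      w≡ = m+[n∸m]≡n w-lower

      r<q^k : r < q ^ k
      r<q^k = +-cancelˡ-< (q ^ k * rep i) _ _ (subst (_< q ^ k * rep i + q ^ k) (sym w≡) w-upper)

      w≢0 : NonZero w
      w≢0 = >-nonZero (≤-trans (*-mono-≤ (m^n>0 q k) (rep>0 i)) w-lower)
        where
        rep>0 : ∀ i .{{_ : NonZero i}} → 0 < rep i
        rep>0 (suc i) = s≤s z≤n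

      [1+V]w≡ : (1 + V) * w ≡ q ^ k * rep (T + i) + r
      [1+V]w≡ = begin
        (1 + V) * w                                            ≡⟨ lemma δ V₀ w ⟩
        w + δ * (V₀ * w)                                       ≡⟨ cong₂ (λ y z → y + δ * z) (sym w≡) V₀w≡ ⟩
        q ^ k * rep i + r + δ * (q ^ i * (q ^ a * rep T))      ≡⟨ cong (λ y → y * rep i + r + δ * (q ^ i * (q ^ a * rep T))) q^k≡ ⟩
        q ^ a * δ * rep i + r + δ * (q ^ i * (q ^ a * rep T))  ≡⟨ lemma′ (q ^ a) δ (rep i) r (q ^ i) (rep T) ⟩
        q ^ a * δ * (q ^ i * rep T + rep i) + r                ≡⟨ cong₂ (λ y z → y * z + r) q^k≡ (trans (cong rep (+-comm T i)) (rep-+ i T)) ⟨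
        q ^ k * rep (T + i) + r                                ∎
        where
        open ≡-Reasoning
        lemma : ∀ d v w → (1 + d * v) * w ≡ w + d * (v * w)
        lemma = solve-∀
        lemma′ : ∀ a d R r y T → a * d * R + r + d * (y * (a * T)) ≡ a * d * (y * T + R) + r
        lemma′ = solve-∀

      λw : t w ≡ ℤ.- ℤ.+ 1 ℤ.* t w
      λw = begin
        t w                                   ≡⟨ cong t w≡ ⟨
        t (q ^ k * rep i + r)                 ≡⟨ i~ k r r<q^k ⟩
        t (q ^ k * rep (T + i) + r)           ≡⟨ cong t [1+V]w≡ ⟨
        t ((1 + V) * w)                       ≡⟨ t-* (1 + V) w ⟩
        t (1 + V) ℤ.* t w             ≡⟨ cong (ℤ._* t w) λ[1+V] ⟩
        ℤ.- ℤ.+ 1 ℤ.* t w                     ∎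
        where open ≡-Reasoning

    contradictory : ⊥
    contradictory =
      let l , π , π≢0 , dil = dilation
          i , b , i≢0 , b≢0 , i~ = equivalent-repunits
          P , prP , c , P≡ = prime≡1mod-prime-power pq l
          u , x , τ , ε , Pu²≡ , Ax≡ , ε-small =
            square-multiple-near-power P (q ^ l) c π i {{m^n≢0 q l}} {{π≢0}} P≡
      in combine l π {{π≢0}} dil i b {{i≢0}} {{b≢0}} i~ P prP u x τ ε Pu²≡ Ax≡ ε-small
      where
      combine : ∀ l π .{{_ : NonZero π}} →
        (∀ x → NonZero x → t (1 + q ^ l * x) ≡ t (1 + q ^ π * (q ^ l * x))) →
        ∀ i b .{{_ : NonZero i}} .{{_ : NonZero b}} → rep i ~ rep (b + i) →
        ∀ P → Prime P → ∀ u x τ ε → P * (u * u) ≡ 1 + q ^ l * x →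
        q ^ l * x ≡ q ^ (π * τ) + ε → (ε + 1) * q ^ i ≤ q ^ (π * τ) → ⊥
      combine l π dil i b i~ P prP u x τ ε Pu²≡ Ax≡ ε-small = finish (divides-rep V₀ {{V₀≢0}})
        where
        V₀ : ℕ
        V₀ = q ^ l * x
        V₀≢0 : NonZero V₀
        V₀≢0 = >-nonZero (subst (0 <_) (sym Ax≡) (≤-trans (m^n>0 q (π * τ)) (m≤m+n _ ε)))
        x≢0 : NonZero x
        x≢0 = m*n≢0⇒n≢0 (q ^ l) {{V₀≢0}}

        finish : ∃₂ (λ a s → NonZero s × V₀ ∣ q ^ a * rep s) → ⊥
        finish (a , s , s≢0 , V₀∣) with ∣-trans V₀∣ (*-monoʳ-∣ (q ^ a)
          (subst (λ e → rep s ∣ rep e) (lemma π (suc τ) b s) (rep-∣ (π * suc τ * b) s)))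
          where
          lemma : ∀ π z b s → π * z * b * s ≡ π * (s * z) * b
          lemma = solve-∀
        ... | divides z z≡ = equivalent-repunits-exclude i T (π * j) V₀ (δ * ε) a z {{it}} {{V₀≢0}}
          (~-iterate (π * (s * suc τ)) i~) λ[1+V] V≡ δε-small z≡
          where
          instance _ = s≢0
          instance
            bs≢0 : NonZero (b * s)
            bs≢0 = m*n≢0 b s
          j T δ : ℕ
          -- `T` is a multiple of s, so V₀ divides q^a · `rep T`, and a multiple of b, so the
          -- equivalence of repunits reaches length T + i. Then `j` is forced by T = π j + π τ,
          -- which places δ V₀ just above q^T.
          j = b * s * suc τ ∸ τ
          T = π * (s * suc τ) * b
          δ = q ^ (π * j)

          t≡ : T ≡ π * j + π * τ
          t≡ = begin
            π * (s * suc τ) * b      ≡⟨ lemma π s (suc τ) b ⟩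
            π * (b * s * suc τ)      ≡⟨ cong (π *_) (m∸n+n≡m (≤-trans (n≤1+n τ) (m≤n*m (suc τ) (b * s)))) ⟨
            π * (j + τ)              ≡⟨ *-distribˡ-+ π j τ ⟩
            π * j + π * τ            ∎
            where
            open ≡-Reasoning
            lemma : ∀ π s z b → π * (s * z) * b ≡ π * (b * s * z)
            lemma = solve-∀

          q^t≡ : q ^ T ≡ δ * q ^ (π * τ)
          q^t≡ = trans (cong (q ^_) t≡) (^-distribˡ-+-* q (π * j) (π * τ))

          V≡ : δ * V₀ ≡ q ^ T + δ * ε
          V≡ = trans (cong (δ *_) Ax≡)
            (trans (*-distribˡ-+ δ (q ^ (π * τ)) ε) (cong (_+ δ * ε) (sym q^t≡)))

          δε-small : (δ * ε + 1) * q ^ i ≤ q ^ T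
          δε-small = begin
            -- Dilation multiplies ε and the power of q by the same δ, so the relative precision
            -- survives; the extra 1 is bounded by δ.
            (δ * ε + 1) * q ^ i         ≤⟨ *-monoˡ-≤ (q ^ i) (+-monoʳ-≤ (δ * ε) (m^n>0 q (π * j))) ⟩
            (δ * ε + δ) * q ^ i         ≡⟨ lemma δ ε (q ^ i) ⟩
            δ * ((ε + 1) * q ^ i)       ≤⟨ *-monoʳ-≤ δ ε-small ⟩
            δ * q ^ (π * τ)             ≡⟨ q^t≡ ⟨
            q ^ T                       ∎
            where
            open ≤-Reasoning
            lemma : ∀ d e x → (d * e + d) * x ≡ d * ((e + 1) * x)
            lemma = solve-∀

          λ[1+V] : t (1 + δ * V₀) ≡ ℤ.- ℤ.+ 1
          λ[1+V] = begin
            t (1 + δ * V₀)                             ≡⟨ dilations l π dil j x x≢0 ⟨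
            t (1 + q ^ l * x)                         ≡⟨ cong t Pu²≡ ⟨
            t (P * (u * u))                       ≡⟨ t-* P (u * u) ⟩
            t P ℤ.* t (u * u)             ≡⟨ cong₂ ℤ._*_ (t-prime prP) (trans (t-* u u) (IsSign-square (t-sign u {{u≢0}}))) ⟩
            ℤ.- ℤ.+ 1                                     ∎
            where
            open ≡-Reasoning
            u≢0 : NonZero u
            u≢0 = ≢-nonZero λ { refl → 0≢1+n (trans (sym (*-zeroʳ P)) Pu²≡) }

  liouville-not-prime-automatic : ∀ {q} → Prime q → ¬ Automatic q liouville
  liouville-not-prime-automatic pq finite = FiniteKernel.contradictory liouville liouville-* liouville-sign liouville-prime pq finite

-- From a prime base to an arbitrary base.

module AnyBase where

  open import Defs
  open LiouvilleFunction
  open PrimesInProgressions using (prime-divisor)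
  open PrimeBase using (liouville-not-prime-automatic)
  open import Data.Nat
  open import Data.Nat.Properties
  open import Data.Nat.Divisibility using (divides)
  open import Data.Nat.Tactic.RingSolver using (solve-∀)
  open import Data.Integer as ℤ using (ℤ)
  import Data.Integer.Properties as ℤP
  open import Data.List using (_++_; map)
  open import Data.List.Relation.Unary.Any as Any using (Any)
  open import Data.List.Relation.Unary.Any.Properties using (++⁺ˡ; ++⁺ʳ; map⁺)
  open import Data.Product using (_,_)
  open import Data.Sum using (inj₁; inj₂)
  open import Relation.Nullary using (¬_)
  open import Relation.Binary.PropositionalEquality

  ^-distribʳ-* : ∀ m n l → (m * n) ^ l ≡ m ^ l * n ^ l
  ^-distribʳ-* m n zero    = refl
  ^-distribʳ-* m n (suc l) = trans (cong (m * n *_) (^-distribʳ-* m n l)) (lemma m n (m ^ l) (n ^ l))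
    where lemma : ∀ m n x y → m * n * (x * y) ≡ m * x * (n * y)
          lemma = solve-∀

  module _ (t : ℕ → ℤ) (t-* : ∀ m n → t (m * n) ≡ t m ℤ.* t n)
           (t-sign : ∀ n .{{_ : NonZero n}} → IsSign (t n)) where

    -- The sign t(m^l) may vary with l, so a kernel sequence in base p is one in base m p or the
    -- negative of one. The cover is therefore enlarged by its negatives.
    automatic-factor : ∀ m p .{{_ : NonZero m}} → Automatic (m * p) t → Automatic p t
    automatic-factor m p (S , cover) = S ++ map (λ s i → ℤ.- s i) S , cover′
      where
      cover′ : ∀ l r → r < p ^ l →
               Any (λ s → ∀ i → s i ≡ kernelSeq p t l r i) (S ++ map (λ s i → ℤ.- s i) S)
      cover′ l r r< = place (t-sign M {{m^n≢0 m l}})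
        where
        M = m ^ l
        Mr< : M * r < (m * p) ^ l
        Mr< = subst (M * r <_) (sym (^-distribʳ-* m p l)) (*-monoʳ-< M {{m^n≢0 m l}} r<)

        scale : ∀ i → kernelSeq (m * p) t l (M * r) i ≡ t M ℤ.* kernelSeq p t l r i
        scale i = trans (cong t (trans (cong (λ x → x * suc i + M * r) (^-distribʳ-* m p l))
                                       (factor M (p ^ l) (suc i) r)))
                        (t-* M (p ^ l * suc i + r))
          where factor : ∀ a b n r → a * b * n + a * r ≡ a * (b * n + r)
                factor = solve-∀

        place : IsSign (t M) → Any (λ s → ∀ i → s i ≡ kernelSeq p t l r i) (S ++ map (λ s i → ℤ.- s i) S)
        place (inj₁ tM≡1) = ++⁺ˡ (Any.map (λ s≡ i → trans (s≡ i) (trans (scale i)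
          (trans (cong (ℤ._* kernelSeq p t l r i) tM≡1) (ℤP.*-identityˡ _)))) (cover l (M * r) Mr<))
        place (inj₂ tM≡-) = ++⁺ʳ S (map⁺ (Any.map (λ s≡ i → trans (cong ℤ.-_ (trans (s≡ i) (trans (scale i)
          (trans (cong (ℤ._* kernelSeq p t l r i) tM≡-) (ℤP.-1*i≡-i _))))) (ℤP.neg-involutive _)) (cover l (M * r) Mr<)))

  liouville-not-automatic : ∀ k → 2 ≤ k → ¬ Automatic k liouville
  liouville-not-automatic k 2≤k auto with prime-divisor k 2≤k
  ... | p , pr , divides m refl = liouville-not-prime-automatic pr
    (automatic-factor liouville liouville-* liouville-sign m p {{m*n≢0⇒m≢0 m {{>-nonZero (<-trans z<s 2≤k)}}}} auto)

-- Polynomial dependence among prescribed powers of an algebraic element.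

module LinearAlgebra where

  open import Algebra.Bundles using (CommutativeRing)
  open import Data.Nat using (ℕ; zero; suc; _<_; s≤s; z<s; s<s)
  import Data.Nat.Properties as ℕP
  open import Data.Fin as Fin using (Fin; toℕ; fromℕ<; punchIn; punchOut)
  import Data.Fin.Properties as Fin
  open import Data.Product using (∃; ∃₂; _×_; _,_)
  open import Data.Sum using (_⊎_; inj₁; inj₂)
  open import Function using (_∘_)
  open import Level using (0ℓ)
  open import Relation.Nullary using (¬_; yes; no; contradiction)
  import Relation.Binary.PropositionalEquality as ≡
  open ≡ using (_≡_)

  module Sums (R : CommutativeRing 0ℓ 0ℓ) where

    open CommutativeRing R
    open import Algebra.Properties.Ring ring using (-‿distribˡ-*; -‿+-comm; -0#≈0#)
    open import Algebra.Properties.CommutativeSemigroup +-commutativeSemigroup using (interchange)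
    open import Relation.Binary.Reasoning.Setoid setoid

    Σ< : ℕ → (ℕ → Carrier) → Carrier
    Σ< zero    F = 0#
    Σ< (suc n) F = F 0 + Σ< n (F ∘ suc)

    Σ-cong : ∀ n {F G : ℕ → Carrier} → (∀ i → i < n → F i ≈ G i) → Σ< n F ≈ Σ< n G
    Σ-cong zero    F≈G = refl
    Σ-cong (suc n) F≈G = +-cong (F≈G 0 z<s) (Σ-cong n λ i i<n → F≈G (suc i) (s<s i<n))

    Σ-zero : ∀ n {F : ℕ → Carrier} → (∀ i → i < n → F i ≈ 0#) → Σ< n F ≈ 0#
    Σ-zero zero    F≈0 = refl
    Σ-zero (suc n) F≈0 = trans (+-cong (F≈0 0 z<s) (Σ-zero n λ i i<n → F≈0 (suc i) (s<s i<n))) (+-identityˡ 0#)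

    Σ-+ : ∀ n (F G : ℕ → Carrier) → Σ< n (λ i → F i + G i) ≈ Σ< n F + Σ< n G
    Σ-+ zero    F G = sym (+-identityˡ 0#)
    Σ-+ (suc n) F G = trans (+-congˡ (Σ-+ n (F ∘ suc) (G ∘ suc))) (interchange _ _ _ _)

    Σ-*ˡ : ∀ n x (F : ℕ → Carrier) → x * Σ< n F ≈ Σ< n (λ i → x * F i)
    Σ-*ˡ zero    x F = zeroʳ x
    Σ-*ˡ (suc n) x F = trans (distribˡ x _ _) (+-congˡ (Σ-*ˡ n x (F ∘ suc)))

    Σ-*ʳ : ∀ n x (F : ℕ → Carrier) → Σ< n F * x ≈ Σ< n (λ i → F i * x)
    Σ-*ʳ zero    x F = zeroˡ x
    Σ-*ʳ (suc n) x F = trans (distribʳ x _ _) (+-congˡ (Σ-*ʳ n x (F ∘ suc)))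

    Σ-neg : ∀ n (F : ℕ → Carrier) → - Σ< n F ≈ Σ< n (λ i → - F i)
    Σ-neg zero    F = -0#≈0#
    Σ-neg (suc n) F = trans (sym (-‿+-comm _ _)) (+-congˡ (Σ-neg n (F ∘ suc)))

    Σ-last : ∀ n (F : ℕ → Carrier) → Σ< (suc n) F ≈ Σ< n F + F n
    Σ-last zero    F = +-comm _ _
    Σ-last (suc n) F = trans (+-congˡ (Σ-last n (F ∘ suc))) (sym (+-assoc _ _ _))

    Σ-comm : ∀ m n (F : ℕ → ℕ → Carrier) → Σ< m (λ i → Σ< n (F i)) ≈ Σ< n (λ j → Σ< m (λ i → F i j))
    Σ-comm zero    n F = sym (Σ-zero n λ _ _ → refl)
    Σ-comm (suc m) n F = trans (+-congˡ (Σ-comm m n (F ∘ suc))) (sym (Σ-+ n (F 0) _))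

    δ : ℕ → ℕ → Carrier
    δ zero    zero    = 1#
    δ zero    (suc _) = 0#
    δ (suc _) zero    = 0#
    δ (suc i) (suc j) = δ i j

    Σ-δ : ∀ n i (F : ℕ → Carrier) → i < n → Σ< n (λ j → δ i j * F j) ≈ F i
    Σ-δ (suc n) zero F _ = begin
      1# * F 0 + Σ< n (λ j → 0# * F (suc j))  ≈⟨ +-cong (*-identityˡ _) (Σ-zero n λ j _ → zeroˡ _) ⟩
      F 0 + 0#                                ≈⟨ +-identityʳ _ ⟩
      F 0                                     ∎
    Σ-δ (suc n) (suc i) F (s≤s i<n) = begin
      0# * F 0 + Σ< n (λ j → δ i j * F (suc j))  ≈⟨ +-cong (zeroˡ _) (Σ-δ n i (F ∘ suc) i<n) ⟩
      0# + F (suc i)                             ≈⟨ +-identityˡ _ ⟩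
      F (suc i)                                  ∎

  -- A subring of "polynomials" in a ring of power series, with a positive notion of
  -- being nonzero that is decidable on polynomials.
  record Polynomials (R : CommutativeRing 0ℓ 0ℓ) : Set₁ where
    open CommutativeRing R
    field
      Poly      : Carrier → Set
      NonZ      : Carrier → Set
      poly-0    : Poly 0#
      poly-1    : Poly 1#
      poly-+    : ∀ {x y} → Poly x → Poly y → Poly (x + y)
      poly-*    : ∀ {x y} → Poly x → Poly y → Poly (x * y)
      poly-neg  : ∀ {x} → Poly x → Poly (- x)
      nonZ-1    : NonZ 1#
      nonZ-*    : ∀ {x y} → NonZ x → NonZ y → NonZ (x * y)
      nonZ⇒≉0   : ∀ {x} → NonZ x → ¬ x ≈ 0#
      nonZ?     : ∀ {x} → Poly x → NonZ x ⊎ x ≈ 0#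

  module Dependence {R : CommutativeRing 0ℓ 0ℓ} (𝒫 : Polynomials R) where

    open CommutativeRing R
    open Polynomials 𝒫
    open Sums R
    open import Algebra.Properties.Ring ring using (-‿distribˡ-*; -‿distribʳ-*)
    open import Algebra.Properties.Group +-group using (inverseˡ-unique)
    open import Algebra.Properties.Semiring.Exp semiring using (_^_)
    open import Algebra.Properties.CommutativeSemigroup *-commutativeSemigroup
      using (x∙yz≈y∙xz; interchange)
    open import Relation.Binary.Reasoning.Setoid setoid

    poly-Σ : ∀ n {F} → (∀ i → Poly (F i)) → Poly (Σ< n F)
    poly-Σ zero    _ = poly-0
    poly-Σ (suc n) p = poly-+ (p 0) (poly-Σ n (p ∘ suc))

    poly-^ : ∀ {x} n → Poly x → Poly (x ^ n)
    poly-^ zero    _ = poly-1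
    poly-^ (suc n) p = poly-* p (poly-^ n p)

    nonZ-^ : ∀ {x} n → NonZ x → NonZ (x ^ n)
    nonZ-^ zero    _ = nonZ-1
    nonZ-^ (suc n) z = nonZ-* z (nonZ-^ n z)

    poly-δ : ∀ i j → Poly (δ i j)
    poly-δ zero    zero    = poly-1
    poly-δ zero    (suc _) = poly-0
    poly-δ (suc _) zero    = poly-0
    poly-δ (suc i) (suc j) = poly-δ i j

    all-zero-or-nonZ : ∀ n (v : Fin n → Carrier) → (∀ c → Poly (v c)) →
                       (∃ λ c → NonZ (v c)) ⊎ (∀ c → v c ≈ 0#)
    all-zero-or-nonZ zero    v p = inj₂ λ ()
    all-zero-or-nonZ (suc n) v p with nonZ? (p Fin.zero) | all-zero-or-nonZ n (v ∘ Fin.suc) (p ∘ Fin.suc)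
    ... | inj₁ nz | _             = inj₁ (Fin.zero , nz)
    ... | inj₂ z  | inj₁ (c , nz) = inj₁ (Fin.suc c , nz)
    ... | inj₂ z  | inj₂ zs       = inj₂ λ { Fin.zero → z ; (Fin.suc c) → zs c }

    Dependent : ∀ m n → (ℕ → Fin n → Carrier) → Set
    Dependent m n v = ∃ λ (b : ℕ → Carrier) → (∀ j → Poly (b j)) × (∃ λ j → j < m × NonZ (b j)) ×
                      (∀ c → Σ< m (λ j → b j * v j c) ≈ 0#)

    -- Gaussian elimination with pivots taken from row 0.
    dependent : ∀ n (v : ℕ → Fin n → Carrier) → (∀ j c → Poly (v j c)) → Dependent (suc n) n v
    dependent n v poly-v with all-zero-or-nonZ n (v 0) (poly-v 0)
    ... | inj₂ v₀≈0 = δ 0 , poly-δ 0 , (0 , z<s , nonZ-1) , λ c →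
      trans (Σ-δ (suc n) 0 (λ j → v j c) z<s) (v₀≈0 c)
    dependent (suc n) v poly-v | inj₁ (c₀ , pivot≉0) with dependent n w poly-w
      where
      w : ℕ → Fin n → Carrier
      -- Elimination without fractions: each later row is scaled by the pivot before a multiple of
      -- row 0 is subtracted, so all entries remain polynomials.
      w j c = v 0 c₀ * v (suc j) (punchIn c₀ c) + - (v (suc j) c₀ * v 0 (punchIn c₀ c))
      poly-w : ∀ j c → Poly (w j c)
      poly-w j c = poly-+ (poly-* (poly-v _ _) (poly-v _ _)) (poly-neg (poly-* (poly-v _ _) (poly-v _ _)))
    ... | b′ , poly-b′ , (j₀ , j₀<n , b′≉0) , rel = b , poly-b , (suc j₀ , s<s j₀<n , nonZ-* pivot≉0 b′≉0) , rel′
      where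
      a = v 0 c₀
      s : Fin (suc n) → Carrier
      s c = Σ< (suc n) (λ j → b′ j * v (suc j) c)
      b : ℕ → Carrier
      -- With the other weights scaled by the pivot, the weight of row 0 is forced by cancellation
      -- in the pivot column.
      b zero    = - s c₀
      b (suc j) = a * b′ j
      poly-b : ∀ j → Poly (b j)
      poly-b zero    = poly-neg (poly-Σ (suc n) λ j → poly-* (poly-b′ j) (poly-v (suc j) c₀))
      poly-b (suc j) = poly-* (poly-v _ _) (poly-b′ j)

      expand : ∀ c → Σ< (suc (suc n)) (λ j → b j * v j c) ≈ a * s c + - (s c₀ * v 0 c)
      expand c = begin
        - s c₀ * v 0 c + Σ< (suc n) (λ j → a * b′ j * v (suc j) c)
          ≈⟨ +-cong (sym (-‿distribˡ-* _ _)) (Σ-cong (suc n) λ j _ → *-assoc a (b′ j) (v (suc j) c)) ⟩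
        - (s c₀ * v 0 c) + Σ< (suc n) (λ j → a * (b′ j * v (suc j) c))
          ≈⟨ +-congˡ (Σ-*ˡ (suc n) a (λ j → b′ j * v (suc j) c)) ⟨
        - (s c₀ * v 0 c) + a * s c
          ≈⟨ +-comm _ _ ⟩
        a * s c + - (s c₀ * v 0 c) ∎

      rel′ : ∀ c → Σ< (suc (suc n)) (λ j → b j * v j c) ≈ 0#
      rel′ c with c₀ Fin.≟ c
      ... | yes ≡.refl = trans (expand c₀) (trans (+-congˡ (-‿cong (*-comm _ _))) (-‿inverseʳ _))
      ... | no  c₀≢c   = trans (expand c) (trans (sym collect) (rel (punchOut c₀≢c)))
        where
        c′ = punchIn c₀ (punchOut c₀≢c)
        collect : Σ< (suc n) (λ j → b′ j * (a * v (suc j) c′ + - (v (suc j) c₀ * v 0 c′))) ≈ a * s c + - (s c₀ * v 0 c)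
        collect rewrite Fin.punchIn-punchOut c₀≢c = begin
          Σ< (suc n) (λ j → b′ j * (a * v (suc j) c + - (v (suc j) c₀ * v 0 c)))
            ≈⟨ Σ-cong (suc n) (λ j _ → distribute (b′ j) (v (suc j) c) (v (suc j) c₀) (v 0 c)) ⟩
          Σ< (suc n) (λ j → a * (b′ j * v (suc j) c) + - (b′ j * v (suc j) c₀ * v 0 c))
            ≈⟨ Σ-+ (suc n) (λ j → a * (b′ j * v (suc j) c)) (λ j → - (b′ j * v (suc j) c₀ * v 0 c)) ⟩
          Σ< (suc n) (λ j → a * (b′ j * v (suc j) c)) + Σ< (suc n) (λ j → - (b′ j * v (suc j) c₀ * v 0 c))
            ≈⟨ +-cong (Σ-*ˡ (suc n) a (λ j → b′ j * v (suc j) c)) (trans (-‿cong (Σ-*ʳ (suc n) (v 0 c) (λ j → b′ j * v (suc j) c₀))) (Σ-neg (suc n) (λ j → b′ j * v (suc j) c₀ * v 0 c))) ⟨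
          a * s c + - (s c₀ * v 0 c) ∎
          where
          distribute : ∀ x y z w → x * (a * y + - (z * w)) ≈ a * (x * y) + - (x * z * w)
          distribute x y z w = trans (distribˡ _ _ _) (+-cong (x∙yz≈y∙xz _ _ _)
            (trans (sym (-‿distribʳ-* _ _)) (-‿cong (sym (*-assoc _ _ _)))))

    module _ (f : Carrier) where

      Relation : (ℕ → ℕ) → ℕ → (ℕ → Carrier) → Set
      Relation ε m a = (∀ j → Poly (a j)) × (∃ λ j → j < m × NonZ (a j)) × Σ< m (λ j → a j * f ^ ε j) ≈ 0#

      record Span (e : ℕ) (h : Carrier) : Set where
        constructor span
        field
          coeffs : ℕ → Carrier
          poly   : ∀ i → Poly (coeffs i)
          combo  : h ≈ Σ< e (λ i → coeffs i * f ^ i)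
      open Span

      span-cong : ∀ {e g h} → g ≈ h → Span e g → Span e h
      span-cong g≈h (span c p eq) = span c p ( trans (sym g≈h) eq)

      span-0 : ∀ {e} → Span e 0#
      span-0 {e} = span (λ _ → 0#) (λ _ → poly-0) (sym (Σ-zero e λ i _ → zeroˡ _))

      span-+ : ∀ {e g h} → Span e g → Span e h → Span e (g + h)
      span-+ {e} (span c p eq) (span c′ p′ eq′) = span (λ i → c i + c′ i) (λ i → poly-+ (p i) (p′ i))
        (trans (+-cong eq eq′) (trans (sym (Σ-+ e _ _)) (Σ-cong e λ i _ → sym (distribʳ _ _ _))))

      span-* : ∀ {e x h} → Poly x → Span e h → Span e (x * h)
      span-* {e} {x} px (span c p eq) = span (λ i → x * c i) (λ i → poly-* px (p i))
        (trans (*-congˡ eq) (trans (Σ-*ˡ e x _) (Σ-cong e λ i _ → sym (*-assoc _ _ _))))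

      span-power : ∀ {e} i → i < e → Span e (f ^ i)
      span-power {e} i i<e = span (δ i) (poly-δ i) (sym (Σ-δ e i (f ^_) i<e))

      span-Σ : ∀ {e} n {F} → (∀ i → i < n → Span e (F i)) → Span e (Σ< n F)
      span-Σ zero    sp = span-0
      span-Σ (suc n) sp = span-+ (sp 0 z<s) (span-Σ n λ i i<n → sp (suc i) (s<s i<n))

      -- Vanishing top coefficients are discarded one by one, which is possible because nonvanishing
      -- is decidable for polynomials. The first nonzero one becomes Q, and the lower terms move to
      -- the other side.
      leading : ∀ n (P : ℕ → Carrier) → (∀ i → Poly (P i)) → (∃ λ i → i < n × NonZ (P i)) →
                Σ< n (λ i → P i * f ^ i) ≈ 0# →
                ∃₂ λ (e : ℕ) (Q : Carrier) → Poly Q × NonZ Q × Span e (Q * f ^ e)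
      leading zero    P p (_ , () , _) rel
      leading (suc n) P p (i , i<1+n , nz) rel with nonZ? (p n)
      ... | inj₁ Q≉0 = n , P n , p n , Q≉0 , span (λ i → - P i) (λ i → poly-neg (p i)) (begin
        P n * f ^ n                        ≈⟨ inverseˡ-unique _ _ (trans (+-comm _ _) (trans (sym (Σ-last n _)) rel)) ⟩
        - Σ< n (λ i → P i * f ^ i)         ≈⟨ Σ-neg n _ ⟩
        Σ< n (λ i → - (P i * f ^ i))       ≈⟨ Σ-cong n (λ i _ → -‿distribˡ-* _ _) ⟩
        Σ< n (λ i → - P i * f ^ i)         ∎)
      ... | inj₂ Pn≈0 = leading n P p (i , i<n , nz) (begin
        Σ< n (λ i → P i * f ^ i)                  ≈⟨ +-identityʳ _ ⟨
        Σ< n (λ i → P i * f ^ i) + 0#             ≈⟨ +-congˡ (trans (*-congʳ Pn≈0) (zeroˡ _)) ⟨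
        Σ< n (λ i → P i * f ^ i) + P n * f ^ n    ≈⟨ Σ-last n _ ⟨
        Σ< (suc n) (λ i → P i * f ^ i)            ≈⟨ rel ⟩
        0#                                        ∎)
        where
        i<n : i < n
        i<n with ℕP.m≤n⇒m<n∨m≡n (ℕP.≤-pred i<1+n)
        ... | inj₁ i<n    = i<n
        ... | inj₂ ≡.refl = contradiction Pn≈0 (nonZ⇒≉0 nz)

      module _ {e Q} (poly-Q : Poly Q) (Q≉0 : NonZ Q) (reduce : Span e (Q * f ^ e)) where

        0<e : ∀ e → Span e (Q * f ^ e) → 0 < e
        0<e zero    (span _ _ eq) = contradiction (trans (sym (*-identityʳ Q)) eq) (nonZ⇒≉0 Q≉0)
        0<e (suc _) _            = z<s

        span-Q*f^ : ∀ i → i < e → Span e (Q * f ^ suc i)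
        span-Q*f^ i i<e with ℕP.m≤n⇒m<n∨m≡n i<e
        ... | inj₁ 1+i<e   = span-* poly-Q (span-power (suc i) 1+i<e)
        ... | inj₂ ≡.refl  = reduce

        -- Q is not invertible, so each reduction of f^e to lower powers costs a factor Q. One
        -- factor per multiplication by f suffices.
        span-all-powers : ∀ j → Span e (Q ^ j * f ^ j)
        span-all-powers zero    = span-* poly-1 (span-power 0 (0<e e reduce))
        span-all-powers (suc j) with span-all-powers j
        ... | span c p eq = span-cong (sym (begin
          Q * Q ^ j * (f * f ^ j)                  ≈⟨ interchange _ _ _ _ ⟩
          Q * f * (Q ^ j * f ^ j)                  ≈⟨ *-congˡ eq ⟩
          Q * f * Σ< e (λ i → c i * f ^ i)         ≈⟨ Σ-*ˡ e _ _ ⟩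
          Σ< e (λ i → Q * f * (c i * f ^ i))       ≈⟨ Σ-cong e (λ i _ → trans (x∙yz≈y∙xz _ _ _) (*-congˡ (*-assoc _ _ _))) ⟩
          Σ< e (λ i → c i * (Q * f ^ suc i))       ∎))
          (span-Σ e λ i i<e → span-* (p i) (span-Q*f^ i i<e))

        -- The e + 1 elements Q^(ε j) f^(ε j) are combinations of only e powers of f, so their
        -- coefficient vectors are dependent. The powers of Q are then moved into the coefficients.
        powers-dependent′ : ∀ ε → ∃₂ (Relation ε)
        powers-dependent′ ε with dependent e (λ j c → coeffs (span-all-powers (ε j)) (toℕ c))
                                             (λ j c → poly (span-all-powers (ε j)) (toℕ c))
        ... | b , poly-b , (j₀ , j₀< , b≉0) , rel =
          suc e , (λ j → b j * Q ^ ε j) , (λ j → poly-* (poly-b j) (poly-^ (ε j) poly-Q)) ,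
          (j₀ , j₀< , nonZ-* b≉0 (nonZ-^ (ε j₀) Q≉0)) , (begin
            Σ< (suc e) (λ j → b j * Q ^ ε j * f ^ ε j)                    ≈⟨ Σ-cong (suc e) (λ j _ → row j) ⟩
            Σ< (suc e) (λ j → Σ< e (λ i → b j * (coeff j i * f ^ i)))     ≈⟨ Σ-comm (suc e) e (λ j i → b j * (coeff j i * f ^ i)) ⟩
            Σ< e (λ i → Σ< (suc e) (λ j → b j * (coeff j i * f ^ i)))     ≈⟨ Σ-zero e vanish ⟩
            0#                                                            ∎)
          where
          coeff : ℕ → ℕ → Carrier
          coeff j = coeffs (span-all-powers (ε j))
          row : ∀ j → b j * Q ^ ε j * f ^ ε j ≈ Σ< e (λ i → b j * (coeff j i * f ^ i))
          row j = trans (*-assoc _ _ _) (trans (*-congˡ (combo (span-all-powers (ε j)))) (Σ-*ˡ e _ _))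
          column : ∀ i → i < e → Σ< (suc e) (λ j → b j * coeff j i) ≈ 0#
          column i i<e = ≡.subst (λ i → Σ< (suc e) (λ j → b j * coeff j i) ≈ 0#) (Fin.toℕ-fromℕ< i<e) (rel (fromℕ< i<e))

          vanish : ∀ i → i < e → Σ< (suc e) (λ j → b j * (coeff j i * f ^ i)) ≈ 0#
          vanish i i<e = begin
            Σ< (suc e) (λ j → b j * (coeff j i * f ^ i))
              ≈⟨ Σ-cong (suc e) {G = λ j → b j * coeff j i * f ^ i} (λ j _ → sym (*-assoc (b j) (coeff j i) (f ^ i))) ⟩
            Σ< (suc e) (λ j → b j * coeff j i * f ^ i)
              ≈⟨ Σ-*ʳ (suc e) (f ^ i) (λ j → b j * coeff j i) ⟨
            Σ< (suc e) (λ j → b j * coeff j i) * f ^ i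
              ≈⟨ *-congʳ (column i i<e) ⟩
            0# * f ^ i
              ≈⟨ zeroˡ _ ⟩
            0# ∎

      powers-dependent : ∀ {n P} → Relation (λ i → i) n P → ∀ ε → ∃₂ (Relation ε)
      powers-dependent {n} {P} (p , nz , rel) ε with leading n P p nz rel
      ... | e , Q , poly-Q , Q≉0 , reduce = powers-dependent′ {e} poly-Q Q≉0 reduce ε

-- Section operators and Christol's finiteness argument.

module Sections where

  open import Defs
  open PowerSeries
  open PrimeCharacteristic
  open LinearAlgebra
  open import Algebra.Bundles using (CommutativeRing)
  open import Data.Nat as ℕ using (ℕ; zero; suc; _≤_; _<_; z≤n; s≤s; z<s; s<s)
  import Data.Nat.Properties as ℕP
  import Data.Nat.Divisibility as ℕD
  open import Data.Nat.Primality using (Prime; euclidsLemma; prime⇒nonZero; prime⇒nonTrivial; ¬prime[1])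
  open import Data.Integer as ℤ using (ℤ; +_; ∣_∣)
  import Data.Integer.Properties as ℤP
  open import Data.Fin as Fin using (Fin; toℕ; fromℕ<)
  import Data.Fin.Properties as Fin
  import Data.Integer.DivMod as ℤDM
  import Data.Integer.Divisibility.Signed as Signed
  open import Data.Product using (∃; ∃₂; _×_; _,_; proj₁; proj₂)
  open import Data.Sum using (_⊎_; inj₁; inj₂)
  open import Data.Empty using (⊥)
  open import Function using (_∘_)
  open import Relation.Nullary using (¬_; Dec; yes; no; contradiction)
  open import Relation.Nullary.Decidable using (map′)
  import Relation.Binary.PropositionalEquality as ≡
  open ≡ using (_≡_; cong; cong₂; subst)

  const : ℤ → PS
  const a zero    = a
  const a (suc _) = + 0

  shift : PS → PS
  shift f zero    = + 0
  shift f (suc n) = f n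

  const-⊛ : ∀ a f n → (const a ⊛ f) n ≡ a ℤ.* f n
  const-⊛ a f zero    = ≡.refl
  const-⊛ a f (suc n) = ≡.trans (⊛-suc (const a) f n)
    (≡.trans (cong (ℤ._+_ (a ℤ.* f (suc n))) (⊛-zeroˡ f n)) (ℤP.+-identityʳ _))

  X : PS
  X = shift 1ₚ

  X-⊛ : ∀ f n → (X ⊛ f) n ≡ shift f n
  X-⊛ f zero    = ≡.refl
  X-⊛ f (suc n) = ≡.trans (⊛-suc X f n) (≡.trans (ℤP.+-identityˡ _) (⊛-identityˡ f n))

  module _ {p : ℕ} (pr : Prime p) where

    private
      instance
        p≢0 : ℕ.NonZero p
        p≢0 = prime⇒nonZero pr

      2≤p : 2 ≤ p
      2≤p = ℕ.nonTrivial⇒n>1 p {{prime⇒nonTrivial pr}}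

      R = PSmod p

    open CommutativeRing R using (semiring; ring; commutativeSemiring; setoid; _≈_; 0#; 1#; +-cong; *-cong; *-congˡ; *-congʳ; +-congˡ; +-congʳ; zeroˡ; *-identityˡ; *-identityʳ; *-assoc; *-comm; +-identityˡ; +-identityʳ; +-comm; distribˡ; distribʳ; refl; sym; trans; -‿cong; -‿inverseʳ)
      renaming (_*_ to infixl 7 _∙_)
    open import Algebra.Properties.Semiring.Exp semiring using (_^_; ^-congˡ; ^-congʳ; ^-homo-*; ^-assocʳ)
    open import Algebra.Properties.CommutativeSemiring.Exp commutativeSemiring using (^-distrib-*)
    open import Algebra.Properties.Semiring.Mult semiring using () renaming (_×_ to _•_)
    open PrimeChar R using (frobenius; fermat)
    open Sums R

    exact : ∀ {f g : PS} → (∀ n → f n ≡ g n) → f ≈ g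
    exact f≡g = pw λ n → reflexive (f≡g n)

    Zero : ℤ → Set
    Zero x = Congruent p x (+ 0)

    zero⇒∣ : ∀ {x} → Zero x → p ℕD.∣ ∣ x ∣
    zero⇒∣ {x} (mod d) = subst (λ z → p ℕD.∣ ∣ z ∣) (ℤP.+-identityʳ x) (Signed.∣⇒∣ᵤ d)

    ∣⇒zero : ∀ {x} → p ℕD.∣ ∣ x ∣ → Zero x
    ∣⇒zero {x} d = mod (Signed.∣ᵤ⇒∣ (subst (λ z → p ℕD.∣ ∣ z ∣) (≡.sym (ℤP.+-identityʳ x)) d))

    zero? : ∀ x → Dec (Zero x)
    zero? x = map′ ∣⇒zero zero⇒∣ (p ℕD.∣? ∣ x ∣)

    zero-* : ∀ x y → Zero (x ℤ.* y) → Zero x ⊎ Zero y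
    zero-* x y xy≈0 with euclidsLemma ∣ x ∣ ∣ y ∣ pr (subst (p ℕD.∣_) (ℤP.abs-* x y) (zero⇒∣ xy≈0))
    ... | inj₁ d = inj₁ (∣⇒zero d)
    ... | inj₂ d = inj₂ (∣⇒zero d)

    zero-+ : ∀ {x y} → Zero x → Zero y → Zero (x ℤ.+ y)
    zero-+ = +-cong-mod

    zero-*ˡ : ∀ {x} y → Zero x → Zero (x ℤ.* y)
    zero-*ˡ y x≈0 = *-cong-mod x≈0 (reflexive ≡.refl)

    zero-*ʳ : ∀ x {y} → Zero y → Zero (x ℤ.* y)
    zero-*ʳ x y≈0 = ≈-trans (*-cong-mod (reflexive {x = x} ≡.refl) y≈0) (reflexive (ℤP.*-zeroʳ x))

    zero-cancelˡ : ∀ {x y} → Zero (x ℤ.+ y) → Zero x → Zero y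
    zero-cancelˡ {x} {y} x+y≈0 x≈0 = ≈-trans (reflexive (≡.sym (ℤP.+-identityˡ y)))
      (≈-trans (+-cong-mod (≈-sym x≈0) (reflexive ≡.refl)) x+y≈0)

    ×1≈const : ∀ n → n • 1# ≈ const (+ n)
    ×1≈const zero    = exact λ { zero → ≡.refl ; (suc _) → ≡.refl }
    ×1≈const (suc n) = trans (+-congˡ {1#} (×1≈const n)) (exact λ { zero → ≡.refl ; (suc _) → ≡.refl })

    const-cong : ∀ {a b} → Congruent p a b → const a ≈ const b
    const-cong a≈b = pw λ { zero → a≈b ; (suc _) → reflexive ≡.refl }

    char-PSmod : p • 1# ≈ 0#
    char-PSmod = trans (×1≈const p) (pw λ { zero → ∣⇒zero ℕD.∣-refl ; (suc _) → reflexive ≡.refl })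

    residue≈ : ∀ a → Congruent p a (+ (a ℤDM.%ℕ p))
    residue≈ a = mod (Signed.divides (a ℤDM./ℕ p) (begin
      a ℤ.- + m                              ≡⟨ cong (ℤ._- + m) (ℤDM.a≡a%ℕn+[a/ℕn]*n a p) ⟩
      + m ℤ.+ a ℤDM./ℕ p ℤ.* + p ℤ.- + m     ≡⟨ lemma (+ m) (a ℤDM./ℕ p ℤ.* + p) ⟩
      a ℤDM./ℕ p ℤ.* + p                     ∎))
      where
      open ≡.≡-Reasoning
      open import Data.Integer.Tactic.RingSolver using (solve-∀)
      m = a ℤDM.%ℕ p
      lemma : ∀ x y → x ℤ.+ y ℤ.- x ≡ y
      lemma = solve-∀

    const-^p : ∀ a → const a ^ p ≈ const a
    const-^p a = trans (^-congˡ p a≈m) (trans (fermat pr char-PSmod m) (sym a≈m))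
      where
      m = a ℤDM.%ℕ p
      a≈m : const a ≈ m • 1#
      a≈m = trans (const-cong (residue≈ a)) (sym (×1≈const m))

    -- The recursive form of g(X)^p = g(X^p) over F_p, combining Frobenius with Fermat for the
    -- constant term. It spares the substitution of X^p into a series.
    ^p-decompose : ∀ g → g ^ p ≈ const (g 0) ⊕ X ^ p ∙ tail g ^ p
    ^p-decompose g = begin
      g ^ p                                        ≈⟨ ^-congˡ p (exact decompose) ⟩
      (const (g 0) ⊕ X ∙ tail g) ^ p               ≈⟨ frobenius pr char-PSmod (const (g 0)) (X ∙ tail g) ⟩
      const (g 0) ^ p ⊕ (X ∙ tail g) ^ p           ≈⟨ +-cong (const-^p (g 0)) (^-distrib-* X (tail g) p) ⟩
      const (g 0) ⊕ X ^ p ∙ tail g ^ p             ∎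
      where
      open import Relation.Binary.Reasoning.Setoid setoid
      decompose : ∀ n → g n ≡ (const (g 0) ⊕ X ∙ tail g) n
      decompose zero    = ≡.sym (ℤP.+-identityʳ (g 0))
      decompose (suc n) = ≡.sym (≡.trans (ℤP.+-identityˡ _) (X-⊛ (tail g) (suc n)))

    X^-⊛-≥ : ∀ m f n → ((X ^ m) ∙ f) (m ℕ.+ n) ≡ f n
    X^-⊛-≥ zero    f n = ⊛-identityˡ f n
    X^-⊛-≥ (suc m) f n = ≡.trans (⊛-assoc X (X ^ m) f (suc (m ℕ.+ n)))
      (≡.trans (X-⊛ (X ^ m ∙ f) (suc (m ℕ.+ n))) (X^-⊛-≥ m f n))

    X^-⊛-< : ∀ m f n → n < m → ((X ^ m) ∙ f) n ≡ + 0
    X^-⊛-< (suc m) f zero    _         = ≡.trans (⊛-assoc X (X ^ m) f 0) (X-⊛ (X ^ m ∙ f) 0)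
    X^-⊛-< (suc m) f (suc n) (s≤s n<m) = ≡.trans (⊛-assoc X (X ^ m) f (suc n))
      (≡.trans (X-⊛ (X ^ m ∙ f) (suc n)) (X^-⊛-< m f n n<m))

    -- The Cartier operator: it keeps the exponents congruent to r modulo p and divides by p.
    section : ℕ → PS → PS
    section r f n = f (p ℕ.* n ℕ.+ r)

    section-cong : ∀ r {f g} → f ≈ g → section r f ≈ section r g
    section-cong r f≈g = pw λ n → at f≈g (p ℕ.* n ℕ.+ r)

    -- A p-th power is a series in X^p, so it leaves the section as its p-th root. In the induction
    -- the factor X^p moves the index by p, which is one step of the section and one step from g to
    -- `tail g`.
    section-⊛^p : ∀ r → r < p → ∀ h g → section r (h ∙ g ^ p) ≈ section r h ∙ g
    section-⊛^p r r<p h g = pw (go g)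
      where
      open import Algebra.Properties.CommutativeSemigroup (CommutativeRing.*-commutativeSemigroup R) using (x∙yz≈y∙xz)

      expand : ∀ g → h ∙ g ^ p ≈ const (g 0) ∙ h ⊕ X ^ p ∙ (h ∙ tail g ^ p)
      expand g = trans (*-congˡ {h} (^p-decompose g))
        (trans (distribˡ h (const (g 0)) (X ^ p ∙ tail g ^ p))
          (+-cong (*-comm h (const (g 0))) (x∙yz≈y∙xz h (X ^ p) (tail g ^ p))))

      go : ∀ g n → Congruent p ((h ∙ g ^ p) (p ℕ.* n ℕ.+ r)) ((section r h ∙ g) n)
      go g zero = ≈-trans (at (expand g) (p ℕ.* 0 ℕ.+ r)) (reflexive (begin
        (const (g 0) ∙ h) i ℤ.+ (X ^ p ∙ (h ∙ tail g ^ p)) i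
          ≡⟨ cong₂ ℤ._+_ (const-⊛ (g 0) h i) (X^-⊛-< p (h ∙ tail g ^ p) i i<p) ⟩
        g 0 ℤ.* h i ℤ.+ + 0            ≡⟨ ℤP.+-identityʳ _ ⟩
        g 0 ℤ.* h i                    ≡⟨ ℤP.*-comm (g 0) (h i) ⟩
        h i ℤ.* g 0                    ∎))
        where
        open ≡.≡-Reasoning
        i = p ℕ.* 0 ℕ.+ r
        i<p : i < p
        i<p = subst (λ z → z ℕ.+ r < p) (≡.sym (ℕP.*-zeroʳ p)) r<p
      go g (suc n) = ≈-trans (at (expand g) i) (≈-trans (reflexive (begin
        (const (g 0) ∙ h) i ℤ.+ (X ^ p ∙ (h ∙ tail g ^ p)) i
          ≡⟨ cong₂ ℤ._+_ (≡.trans (const-⊛ (g 0) h i) (ℤP.*-comm (g 0) (h i)))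
               (≡.trans (cong (X ^ p ∙ (h ∙ tail g ^ p)) i≡) (X^-⊛-≥ p (h ∙ tail g ^ p) (p ℕ.* n ℕ.+ r))) ⟩
        h i ℤ.* g 0 ℤ.+ (h ∙ tail g ^ p) (p ℕ.* n ℕ.+ r) ∎))
        (≈-trans (+-cong-mod (reflexive {x = h i ℤ.* g 0} ≡.refl) (go (tail g) n))
          (reflexive (≡.sym (⊛-sucʳ (section r h) g n)))))
        where
        open ≡.≡-Reasoning
        i = p ℕ.* suc n ℕ.+ r
        i≡ : i ≡ p ℕ.+ (p ℕ.* n ℕ.+ r)
        i≡ = ≡.trans (cong (ℕ._+ r) (ℕP.*-suc p n)) (ℕP.+-assoc p (p ℕ.* n) r)

    section-Σ : ∀ r n F → section r (Σ< n F) ≈ Σ< n (λ i → section r (F i))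
    section-Σ r zero    F = refl
    section-Σ r (suc n) F = +-congˡ {section r (F 0)} (section-Σ r n (F ∘ suc))

    NonZero : PS → Set
    NonZero f = ∃ λ n → ¬ Zero (f n)

    -- Vanishing constant terms are stripped off until neither factor has one. The witnesses a and b
    -- bound this search, and Euclid's lemma handles the remaining constant terms.
    ⊛-nonZero : ∀ a b f g → ¬ Zero (f a) → ¬ Zero (g b) → NonZero (f ∙ g)
    ⊛-nonZero a b f g fa≉0 gb≉0 with zero? (f 0) | zero? (g 0)
    ⊛-nonZero zero    b f g fa≉0 gb≉0 | yes f0≈0 | _ = contradiction f0≈0 fa≉0
    ⊛-nonZero (suc a) b f g fa≉0 gb≉0 | yes f0≈0 | _ with ⊛-nonZero a b (tail f) g fa≉0 gb≉0
    ... | n , nz = suc n , λ fg≈0 →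
      nz (zero-cancelˡ (subst Zero (⊛-suc f g n) fg≈0) (zero-*ˡ (g (suc n)) f0≈0))
    ⊛-nonZero a zero    f g fa≉0 gb≉0 | no f0≉0 | yes g0≈0 = contradiction g0≈0 gb≉0
    ⊛-nonZero a (suc b) f g fa≉0 gb≉0 | no f0≉0 | yes g0≈0 with ⊛-nonZero a b f (tail g) fa≉0 gb≉0
    ... | n , nz = suc n , λ fg≈0 →
      nz (zero-cancelˡ (subst Zero (⊛-sucʳ f g n) fg≈0) (zero-*ʳ (f (suc n)) g0≈0))
    ⊛-nonZero a b f g fa≉0 gb≉0 | no f0≉0 | no g0≉0 = 0 , λ fg≈0 → case-⊎ (zero-* (f 0) (g 0) fg≈0)
      where
      case-⊎ : Zero (f 0) ⊎ Zero (g 0) → ⊥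
      case-⊎ (inj₁ z) = f0≉0 z
      case-⊎ (inj₂ z) = g0≉0 z

    cancel₀ : ∀ f g → ¬ Zero (f 0) → f ∙ g ≈ 0# → ∀ n → Zero (g n)
    cancel₀ f g f0≉0 fg≈0 zero with zero-* (f 0) (g 0) (at fg≈0 0)
    ... | inj₁ z = contradiction z f0≉0
    ... | inj₂ z = z
    cancel₀ f g f0≉0 fg≈0 (suc n) = cancel₀ f (tail g) f0≉0 (pw λ m →
      zero-cancelˡ (subst Zero (⊛-sucʳ f g m) (at fg≈0 (suc m))) (zero-*ʳ (f (suc m)) (cancel₀ f g f0≉0 fg≈0 0))) n

    -- Only f comes with a witness, so only f is stripped of vanishing initial coefficients. Once
    -- its constant term is nonzero, the coefficients of g are shown to vanish in turn.
    ⊛-cancel : ∀ a f g → ¬ Zero (f a) → f ∙ g ≈ 0# → g ≈ 0#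
    ⊛-cancel a f g fa≉0 fg≈0 with zero? (f 0)
    ⊛-cancel a       f g fa≉0 fg≈0 | no f0≉0  = pw (cancel₀ f g f0≉0 fg≈0)
    ⊛-cancel zero    f g fa≉0 fg≈0 | yes f0≈0 = contradiction f0≈0 fa≉0
    ⊛-cancel (suc a) f g fa≉0 fg≈0 | yes f0≈0 = ⊛-cancel a (tail f) g fa≉0 (pw λ n →
      zero-cancelˡ (subst Zero (⊛-suc f g n) (at fg≈0 (suc n))) (zero-*ˡ (g (suc n)) f0≈0))

    Deg< : ℕ → PS → Set
    Deg< N f = ∀ n → N ≤ n → Zero (f n)

    deg-mono : ∀ {M N f} → M ≤ N → Deg< M f → Deg< N f
    deg-mono M≤N df n N≤n = df n (ℕP.≤-trans M≤N N≤n)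

    deg-+ : ∀ {N f g} → Deg< N f → Deg< N g → Deg< N (f ⊕ g)
    deg-+ df dg n N≤n = zero-+ (df n N≤n) (dg n N≤n)

    deg-neg : ∀ {N f} → Deg< N f → Deg< N (⊖ f)
    deg-neg df n N≤n = neg-cong-mod (df n N≤n)

    deg-* : ∀ M {N} f g → Deg< M f → Deg< N g → Deg< (M ℕ.+ N) (f ∙ g)
    deg-* zero f g df dg n _ = at (trans (*-congʳ {g} {f} {0#} (pw λ m → df m z≤n)) (zeroˡ g)) n
    deg-* (suc M) f g df dg (suc n) (s≤s M+N≤n) = subst Zero (≡.sym (⊛-suc f g n))
      (zero-+ (zero-*ʳ (f 0) (dg (suc n) (ℕP.≤-trans (ℕP.m≤n+m _ M) (ℕP.m≤n⇒m≤1+n M+N≤n))))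
              (deg-* M (tail f) g (λ m M≤m → df (suc m) (s≤s M≤m)) dg n M+N≤n))

    -- Index n of the section reads index at least p n ≥ 2 n of f. This halving of degree bounds
    -- compensates for the multiplications made between successive sections.
    deg-section : ∀ {N} r f → Deg< (N ℕ.+ N) f → Deg< N (section r f)
    deg-section {N} r f df n N≤n = df (p ℕ.* n ℕ.+ r) (begin
      N ℕ.+ N            ≤⟨ ℕP.+-mono-≤ N≤n N≤n ⟩
      n ℕ.+ n            ≡⟨ cong (n ℕ.+_) (ℕP.+-identityʳ n) ⟨
      2 ℕ.* n            ≤⟨ ℕP.*-monoˡ-≤ n 2≤p ⟩
      p ℕ.* n            ≤⟨ ℕP.m≤m+n (p ℕ.* n) r ⟩
      p ℕ.* n ℕ.+ r      ∎)
      where open ℕP.≤-Reasoning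

    Poly : PS → Set
    Poly f = ∃ λ N → Deg< N f

    nonZero? : ∀ {f} → Poly f → NonZero f ⊎ f ≈ 0#
    nonZero? {f} (N , df) with ℕP.anyUpTo? (λ n → ¬? (zero? (f n))) N
      where open import Relation.Nullary using (¬?)
    ... | yes (n , _ , nz) = inj₁ (n , nz)
    ... | no  none         = inj₂ (pw vanish)
      where
      vanish : ∀ n → Zero (f n)
      vanish n with zero? (f n)
      ... | yes z = z
      ... | no nz with N ℕP.≤? n
      ...   | yes N≤n = df n N≤n
      ...   | no  N≰n = contradiction (n , ℕP.≰⇒> N≰n , nz) none

    1≉0 : ¬ Zero (+ 1)
    1≉0 z = ¬prime[1] (subst Prime (ℕD.∣1⇒≡1 (zero⇒∣ z)) pr)

    polynomials : Polynomials R
    polynomials = record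
      { Poly     = Poly
      ; NonZ     = NonZero
      ; poly-0   = 0 , λ _ _ → reflexive ≡.refl
      ; poly-1   = 1 , λ { (suc _) _ → reflexive ≡.refl }
      ; poly-+   = λ { {f} {g} (M , df) (N , dg) → M ℕ.⊔ N ,
                     deg-+ {f = f} {g} (deg-mono {f = f} (ℕP.m≤m⊔n M N) df) (deg-mono {f = g} (ℕP.m≤n⊔m M N) dg) }
      ; poly-*   = λ { {f} {g} (M , df) (N , dg) → M ℕ.+ N , deg-* M f g df dg }
      ; poly-neg = λ { {f} (N , df) → N , deg-neg {f = f} df }
      ; nonZ-1   = 0 , 1≉0
      ; nonZ-*   = λ { {f} {g} (a , nf) (b , ng) → ⊛-nonZero a b f g nf ng }
      ; nonZ⇒≉0  = λ { (n , nz) f≈0 → nz (at f≈0 n) }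
      ; nonZ?    = nonZero?
      }

    poly-section : ∀ r {f} → Poly f → Poly (section r f)
    poly-section r {f} (N , df) = N , deg-section r f (deg-mono {f = f} (ℕP.m≤m+n N N) df)

    open Dependence polynomials using (Relation; powers-dependent; poly-^; nonZ-^)
    open import Algebra.Properties.Ring ring using (-‿distribˡ-*; -‿distribʳ-*)
    open import Algebra.Properties.Group (CommutativeRing.+-group R) using (inverseˡ-unique)
    open import Relation.Binary.Reasoning.Setoid setoid

    section-relation : ∀ r → r < p → ∀ n (d g : ℕ → PS) →
      section r (Σ< n (λ i → d i ∙ g i ^ p)) ≈ Σ< n (λ i → section r (d i) ∙ g i)
    section-relation r r<p n d g = trans (section-Σ r n (λ i → d i ∙ g i ^ p)) (Σ-cong n λ i _ → section-⊛^p r r<p (d i) (g i))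

    -- Sections strip a vanishing coefficient off the front of the relation.
    separable-relation : ∀ f m a → Relation f (p ℕ.^_) m a →
      ∃₂ λ m (a : ℕ → PS) → (∀ j → Poly (a j)) × NonZero (a 0) × Σ< (suc m) (λ j → a j ∙ f ^ (p ℕ.^ j)) ≈ 0#
    separable-relation f zero    a (_ , (_ , () , _) , _)
    separable-relation f (suc m) a (poly-a , (j , j<m , aj≉0) , rel) with nonZero? (poly-a 0)
    ... | inj₁ a0≉0 = m , a , poly-a , a0≉0 , rel
    separable-relation f (suc m) a (poly-a , (zero , _ , aj≉0) , rel) | inj₂ a0≈0 =
      contradiction (at a0≈0 (proj₁ aj≉0)) (proj₂ aj≉0)
    separable-relation f (suc m) a (poly-a , (suc j , s≤s j<m , (n , ajn≉0)) , rel) | inj₂ a0≈0 =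
      separable-relation f m (λ i → section r (a (suc i)))
        ((λ i → poly-section r (poly-a (suc i))) , (j , j<m , n ℕ./ p , nonzero) , rel′)
      where
      open import Data.Nat.DivMod using (m≡m%n+[m/n]*n; m%n<n)
      -- The residue of a nonzero coefficient's index: this section keeps that coefficient, at index
      -- n / p, so the shortened relation stays nontrivial.
      r = n ℕ.% p
      r<p : r < p
      r<p = m%n<n n p
      n≡ : n ≡ p ℕ.* (n ℕ./ p) ℕ.+ r
      n≡ = ≡.trans (m≡m%n+[m/n]*n n p) (≡.trans (ℕP.+-comm r _) (cong (ℕ._+ r) (ℕP.*-comm (n ℕ./ p) p)))
      nonzero : ¬ Zero (section r (a (suc j)) (n ℕ./ p))
      nonzero = ajn≉0 ∘ subst (λ k → Zero (a (suc j) k)) (≡.sym n≡)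
      rel′ : Σ< m (λ i → section r (a (suc i)) ∙ f ^ (p ℕ.^ i)) ≈ 0#
      rel′ = begin
        Σ< m (λ i → section r (a (suc i)) ∙ f ^ (p ℕ.^ i))
          ≈⟨ section-relation r r<p m (λ i → a (suc i)) (λ i → f ^ (p ℕ.^ i)) ⟨
        section r (Σ< m (λ i → a (suc i) ∙ (f ^ (p ℕ.^ i)) ^ p))
          ≈⟨ section-cong r (Σ-cong m λ i _ → *-congˡ {a (suc i)}
               (trans (^-assocʳ f (p ℕ.^ i) p) (^-congʳ f (ℕP.*-comm (p ℕ.^ i) p)))) ⟩
        section r (Σ< m (λ i → a (suc i) ∙ f ^ (p ℕ.^ suc i)))
          ≈⟨ section-cong r (+-identityˡ (Σ< m (λ i → a (suc i) ∙ f ^ (p ℕ.^ suc i)))) ⟨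
        section r (0# ⊕ Σ< m (λ i → a (suc i) ∙ f ^ (p ℕ.^ suc i)))
          ≈⟨ section-cong r (+-congʳ {Σ< m (λ i → a (suc i) ∙ f ^ (p ℕ.^ suc i))} (trans (*-congʳ {f ^ 1} a0≈0) (zeroˡ (f ^ 1)))) ⟨
        section r (Σ< (suc m) (λ i → a i ∙ f ^ (p ℕ.^ i)))
          ≈⟨ section-cong r rel ⟩
        0# ∎

    poly-bound : ∀ n (F : ℕ → PS) → (∀ i → Poly (F i)) → ∃ λ D → ∀ i → i < n → Deg< D (F i)
    poly-bound zero    F pF = 0 , λ _ ()
    poly-bound (suc n) F pF with pF 0 | poly-bound n (F ∘ suc) (pF ∘ suc)
    ... | M , d | N , ds = M ℕ.⊔ N , λ where
      zero    _         → deg-mono {f = F 0} (ℕP.m≤m⊔n M N) d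
      (suc i) (s≤s i<n) → deg-mono {f = F (suc i)} (ℕP.m≤n⊔m M N) (ds i i<n)

    residue : ℤ → Fin p
    residue x = fromℕ< (ℤDM.n%ℕd<d x p)

    residue-injective : ∀ {x y} → residue x ≡ residue y → Congruent p x y
    residue-injective {x} {y} eq = ≈-trans (residue≈ x) (≈-trans (reflexive (cong +_ (≡.trans (≡.sym (Fin.toℕ-fromℕ< (ℤDM.n%ℕd<d x p)))
      (≡.trans (cong toℕ eq) (Fin.toℕ-fromℕ< (ℤDM.n%ℕd<d y p)))))) (≈-sym (residue≈ y)))

    module _ (m N : ℕ) where

      -- Numbers the m-tuples of polynomials of degree below N over F_p. Coefficients from index N
      -- on are ignored, so injectivity is relative to the degree bound.
      code : (ℕ → PS) → Fin ((p ℕ.^ N) ℕ.^ m)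
      code c = Fin.funToFin λ (i : Fin m) → Fin.funToFin λ (j : Fin N) → residue (c (toℕ i) (toℕ j))

      decode : ∀ c (i : Fin m) (j : Fin N) →
               Fin.finToFun {p} {N} (Fin.finToFun {p ℕ.^ N} {m} (code c) i) j ≡ residue (c (toℕ i) (toℕ j))
      decode c i j = ≡.trans
        (cong (λ z → Fin.finToFun {p} {N} z j) (Fin.finToFun-funToFin (λ i → Fin.funToFin λ (j : Fin N) → residue (c (toℕ i) (toℕ j))) i))
        (Fin.finToFun-funToFin (λ j → residue (c (toℕ i) (toℕ j))) j)

      code-injective : ∀ {c c′} → (∀ i → i < m → Deg< N (c i)) → (∀ i → i < m → Deg< N (c′ i)) →
                       code c ≡ code c′ → ∀ i → i < m → c i ≈ c′ i
      code-injective {c} {c′} bc bc′ eq i i<m = pw agree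
        where
        same-residue : ∀ i j → residue (c (toℕ i) (toℕ j)) ≡ residue (c′ (toℕ i) (toℕ j))
        same-residue i j = ≡.trans (≡.sym (decode c i j))
          (≡.trans (cong (λ z → Fin.finToFun {p} {N} (Fin.finToFun {p ℕ.^ N} {m} z i) j) eq) (decode c′ i j))
        agree : ∀ j → Congruent p (c i j) (c′ i j)
        agree j with N ℕP.≤? j
        ... | yes N≤j = ≈-trans (bc i i<m j N≤j) (≈-sym (bc′ i i<m j N≤j))
        ... | no  N≰j = residue-injective (≡.subst₂ (λ x y → residue (c x y) ≡ residue (c′ x y))
          (Fin.toℕ-fromℕ< i<m) (Fin.toℕ-fromℕ< (ℕP.≰⇒> N≰j)) (same-residue (fromℕ< i<m) (fromℕ< (ℕP.≰⇒> N≰j))))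

    -- With A = a 0 and g = f / A, the relation reads g = - Σ_{i≥1} a_i A^(p^i - 2) g^(p^i), so
    -- the combinations h = Σ_{i≤e} c_i g^(p^i) with coefficients of bounded degree are closed
    -- under sections. Below, denominators are cleared by the factor A^(p^e).
    module Closure (f : PS) (e : ℕ) (a : ℕ → PS) (poly-a : ∀ j → Poly (a j)) (A≉0 : NonZero (a 0))
                   (rel : Σ< (suc (suc e)) (λ j → a j ∙ f ^ (p ℕ.^ j)) ≈ 0#) where

      A : PS
      A = a 0

      -- In terms of g this is A^(p^e) g^(p^i), with exponents arranged so that no quotient occurs.
      T : ℕ → PS
      T i = A ^ (p ℕ.^ e ℕ.∸ p ℕ.^ i) ∙ f ^ (p ℕ.^ i)

      infix 4 _represents_
      _represents_ : (ℕ → PS) → PS → Set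
      c represents h = A ^ (p ℕ.^ e) ∙ h ≈ Σ< (suc e) (λ i → c i ∙ T i)

      -- The value at e is set to 0 because `c (suc e)` lies beyond the range that `_represents_`
      -- constrains.
      lower : (ℕ → PS) → ℕ → PS
      lower c i with i ℕP.<? e
      ... | yes _ = c (suc i)
      ... | no  _ = 0#

      lower-< : ∀ c {i} → i < e → lower c i ≡ c (suc i)
      lower-< c {i} i<e with i ℕP.<? e
      ... | yes _   = ≡.refl
      ... | no  i≮e = contradiction i<e i≮e

      lower-e : ∀ c → lower c e ≡ 0#
      lower-e c with e ℕP.<? e
      ... | yes e<e = contradiction e<e (ℕP.<-irrefl ≡.refl)
      ... | no  _   = ≡.refl

      E : ℕ → PS
      E i = a (suc i) ∙ A ^ (p ℕ.^ suc i ℕ.∸ 2)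

      -- Replacing g by its expression through g^p, ..., g^(p^(e+1)) turns h into a combination of
      -- p-th powers, where `d c i` is the coefficient of (g^(p^i))^p: the later coefficients of `c`
      -- move down by one, and `c 0` is spread by the relation.
      d : (ℕ → PS) → ℕ → PS
      d c i = lower c i ⊕ ⊖ (c 0 ∙ E i)

      2≤p^ : ∀ i → 2 ≤ p ℕ.^ suc i
      2≤p^ i = ℕP.≤-trans 2≤p (ℕP.m≤m*n p (p ℕ.^ i) {{ℕP.m^n≢0 p i}})

      p^-mono : ∀ {i j} → i ≤ j → p ℕ.^ i ≤ p ℕ.^ j
      p^-mono = ℕP.^-monoʳ-≤ p

      -- The factor that raises the common denominator A^(p^e) to its p-th power.
      B : PS
      B = A ^ (p ℕ.^ suc e ℕ.∸ p ℕ.^ e)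

      ∸-telescope : ∀ {x y z} → z ≤ y → y ≤ x → (x ℕ.∸ y) ℕ.+ (y ℕ.∸ z) ≡ x ℕ.∸ z
      ∸-telescope {x} {y} {z} z≤y y≤x = ≡.trans (≡.sym (ℕP.+-∸-assoc (x ℕ.∸ y) z≤y)) (cong (ℕ._∸ z) (ℕP.m∸n+n≡m y≤x))

      T^p : ∀ i → T i ^ p ≈ A ^ (p ℕ.^ suc e ℕ.∸ p ℕ.^ suc i) ∙ f ^ (p ℕ.^ suc i)
      T^p i = begin
        T i ^ p
          ≈⟨ ^-distrib-* (A ^ (p ℕ.^ e ℕ.∸ p ℕ.^ i)) (f ^ (p ℕ.^ i)) p ⟩
        (A ^ (p ℕ.^ e ℕ.∸ p ℕ.^ i)) ^ p ∙ (f ^ (p ℕ.^ i)) ^ p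
          ≈⟨ *-cong (^-assocʳ A (p ℕ.^ e ℕ.∸ p ℕ.^ i) p) (^-assocʳ f (p ℕ.^ i) p) ⟩
        A ^ ((p ℕ.^ e ℕ.∸ p ℕ.^ i) ℕ.* p) ∙ f ^ (p ℕ.^ i ℕ.* p)
          ≈⟨ *-cong (^-congʳ A (≡.trans (ℕP.*-comm _ p) (ℕP.*-distribˡ-∸ p (p ℕ.^ e) (p ℕ.^ i)))) (^-congʳ f (ℕP.*-comm (p ℕ.^ i) p)) ⟩
        A ^ (p ℕ.^ suc e ℕ.∸ p ℕ.^ suc i) ∙ f ^ (p ℕ.^ suc i) ∎

      B∙T : ∀ i → i ≤ e → B ∙ T i ≈ A ^ (p ℕ.^ suc e ℕ.∸ p ℕ.^ i) ∙ f ^ (p ℕ.^ i)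
      B∙T i i≤e = begin
        B ∙ T i
          ≈⟨ *-assoc B (A ^ (p ℕ.^ e ℕ.∸ p ℕ.^ i)) (f ^ (p ℕ.^ i)) ⟨
        B ∙ A ^ (p ℕ.^ e ℕ.∸ p ℕ.^ i) ∙ f ^ (p ℕ.^ i)
          ≈⟨ *-congʳ {f ^ (p ℕ.^ i)} (^-homo-* A (p ℕ.^ suc e ℕ.∸ p ℕ.^ e) (p ℕ.^ e ℕ.∸ p ℕ.^ i)) ⟨
        A ^ ((p ℕ.^ suc e ℕ.∸ p ℕ.^ e) ℕ.+ (p ℕ.^ e ℕ.∸ p ℕ.^ i)) ∙ f ^ (p ℕ.^ i)
          ≈⟨ *-congʳ {f ^ (p ℕ.^ i)} (^-congʳ A (∸-telescope (p^-mono i≤e) (p^-mono (ℕP.n≤1+n e)))) ⟩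
        A ^ (p ℕ.^ suc e ℕ.∸ p ℕ.^ i) ∙ f ^ (p ℕ.^ i) ∎

      B∙T0 : B ∙ T 0 ≈ ⊖ Σ< (suc e) (λ i → E i ∙ T i ^ p)
      B∙T0 = begin
        B ∙ T 0
          ≈⟨ B∙T 0 z≤n ⟩
        A ^ (p ℕ.^ suc e ℕ.∸ 1) ∙ f ^ 1
          ≈⟨ *-congʳ {f ^ 1} (trans (^-congʳ A (≡.sym split)) (^-homo-* A (p ℕ.^ suc e ℕ.∸ 2) 1)) ⟩
        A ^ (p ℕ.^ suc e ℕ.∸ 2) ∙ A ^ 1 ∙ f ^ 1
          ≈⟨ trans (*-assoc U (A ^ 1) (f ^ 1)) (*-congˡ {U} (*-congʳ {f ^ 1} (*-identityʳ A))) ⟩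
        U ∙ (A ∙ f ^ 1)
          ≈⟨ *-congˡ {U} (inverseˡ-unique (A ∙ f ^ 1) (Σ< (suc e) (λ i → a (suc i) ∙ f ^ (p ℕ.^ suc i))) rel) ⟩
        U ∙ ⊖ Σ< (suc e) (λ i → a (suc i) ∙ f ^ (p ℕ.^ suc i))
          ≈⟨ -‿distribʳ-* U (Σ< (suc e) (λ i → a (suc i) ∙ f ^ (p ℕ.^ suc i))) ⟨
        ⊖ (U ∙ Σ< (suc e) (λ i → a (suc i) ∙ f ^ (p ℕ.^ suc i)))
          ≈⟨ -‿cong (trans (Σ-*ˡ (suc e) U (λ i → a (suc i) ∙ f ^ (p ℕ.^ suc i))) (Σ-cong (suc e) regroup)) ⟩
        ⊖ Σ< (suc e) (λ i → E i ∙ T i ^ p) ∎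
        where
        U = A ^ (p ℕ.^ suc e ℕ.∸ 2)
        split : (p ℕ.^ suc e ℕ.∸ 2) ℕ.+ 1 ≡ p ℕ.^ suc e ℕ.∸ 1
        split = ∸-telescope {p ℕ.^ suc e} {2} {1} (s≤s z≤n) (2≤p^ e)
        open import Algebra.Properties.CommutativeSemigroup (CommutativeRing.*-commutativeSemigroup R) using (x∙yz≈y∙xz)
        regroup : ∀ i → i < suc e → U ∙ (a (suc i) ∙ f ^ (p ℕ.^ suc i)) ≈ E i ∙ T i ^ p
        regroup i (s≤s i≤e) = begin
          U ∙ (a (suc i) ∙ F)                            ≈⟨ x∙yz≈y∙xz U (a (suc i)) F ⟩
          a (suc i) ∙ (U ∙ F)                            ≈⟨ *-congˡ {a (suc i)} (*-congʳ {F} (trans (^-congʳ A exponent) (^-homo-* A v w))) ⟩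
          a (suc i) ∙ (A ^ v ∙ A ^ w ∙ F)                ≈⟨ *-congˡ {a (suc i)} (*-assoc (A ^ v) (A ^ w) F) ⟩
          a (suc i) ∙ (A ^ v ∙ (A ^ w ∙ F))              ≈⟨ *-assoc (a (suc i)) (A ^ v) (A ^ w ∙ F) ⟨
          E i ∙ (A ^ w ∙ F)                              ≈⟨ *-congˡ {E i} (T^p i) ⟨
          E i ∙ T i ^ p                                  ∎
          where
          F = f ^ (p ℕ.^ suc i)
          v = p ℕ.^ suc i ℕ.∸ 2
          w = p ℕ.^ suc e ℕ.∸ p ℕ.^ suc i
          exponent : p ℕ.^ suc e ℕ.∸ 2 ≡ v ℕ.+ w
          exponent = ≡.trans (≡.sym (∸-telescope (2≤p^ i) (p^-mono (s≤s i≤e)))) (ℕP.+-comm w v)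

      -- Prepares h for a section: both the denominator and every basis element become p-th powers,
      -- so `section-⊛^p` applies on both sides and restores the original denominator and basis.
      raise : ∀ {c h} → c represents h → h ∙ (A ^ (p ℕ.^ e)) ^ p ≈ Σ< (suc e) (λ i → d c i ∙ T i ^ p)
      raise {c} {h} rep = begin
        h ∙ (A ^ (p ℕ.^ e)) ^ p
          ≈⟨ trans (*-comm h ((A ^ (p ℕ.^ e)) ^ p)) (*-congʳ {h} (trans (^-assocʳ A (p ℕ.^ e) p) (^-congʳ A exponent))) ⟩
        A ^ ((p ℕ.^ suc e ℕ.∸ p ℕ.^ e) ℕ.+ p ℕ.^ e) ∙ h
          ≈⟨ trans (*-congʳ {h} (^-homo-* A (p ℕ.^ suc e ℕ.∸ p ℕ.^ e) (p ℕ.^ e))) (*-assoc B (A ^ (p ℕ.^ e)) h) ⟩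
        B ∙ (A ^ (p ℕ.^ e) ∙ h)
          ≈⟨ *-congˡ {B} rep ⟩
        B ∙ Σ< (suc e) (λ i → c i ∙ T i)
          ≈⟨ trans (Σ-*ˡ (suc e) B (λ i → c i ∙ T i)) (Σ-cong (suc e) {G = λ i → c i ∙ (B ∙ T i)} λ i _ → x∙yz≈y∙xz B (c i) (T i)) ⟩
        c 0 ∙ (B ∙ T 0) ⊕ Σ< e (λ i → c (suc i) ∙ (B ∙ T (suc i)))
          ≈⟨ +-cong (*-congˡ {c 0} B∙T0) (Σ-cong e λ i i<e → *-cong (CommutativeRing.reflexive R (≡.sym (lower-< c i<e))) (trans (B∙T (suc i) i<e) (sym (T^p i)))) ⟩
        c 0 ∙ (⊖ Σ< (suc e) (λ i → E i ∙ T i ^ p)) ⊕ Σ< e (λ i → lower c i ∙ T i ^ p)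
          ≈⟨ +-cong left right ⟩
        Σ< (suc e) (λ i → ⊖ (c 0 ∙ E i) ∙ T i ^ p) ⊕ Σ< (suc e) (λ i → lower c i ∙ T i ^ p)
          ≈⟨ Σ-+ (suc e) (λ i → ⊖ (c 0 ∙ E i) ∙ T i ^ p) (λ i → lower c i ∙ T i ^ p) ⟨
        Σ< (suc e) (λ i → ⊖ (c 0 ∙ E i) ∙ T i ^ p ⊕ lower c i ∙ T i ^ p)
          ≈⟨ Σ-cong (suc e) {G = λ i → d c i ∙ T i ^ p} (λ i _ → trans (+-comm (⊖ (c 0 ∙ E i) ∙ T i ^ p) (lower c i ∙ T i ^ p)) (sym (distribʳ (T i ^ p) (lower c i) (⊖ (c 0 ∙ E i))))) ⟩
        Σ< (suc e) (λ i → d c i ∙ T i ^ p) ∎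
        where
        open import Algebra.Properties.CommutativeSemigroup (CommutativeRing.*-commutativeSemigroup R) using (x∙yz≈y∙xz)
        exponent : p ℕ.^ e ℕ.* p ≡ (p ℕ.^ suc e ℕ.∸ p ℕ.^ e) ℕ.+ p ℕ.^ e
        exponent = ≡.trans (ℕP.*-comm (p ℕ.^ e) p) (≡.sym (ℕP.m∸n+n≡m (p^-mono (ℕP.n≤1+n e))))
        left : c 0 ∙ (⊖ Σ< (suc e) (λ i → E i ∙ T i ^ p)) ≈ Σ< (suc e) (λ i → ⊖ (c 0 ∙ E i) ∙ T i ^ p)
        left = begin
          c 0 ∙ (⊖ Σ< (suc e) (λ i → E i ∙ T i ^ p))     ≈⟨ -‿distribʳ-* (c 0) (Σ< (suc e) (λ i → E i ∙ T i ^ p)) ⟨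
          ⊖ (c 0 ∙ Σ< (suc e) (λ i → E i ∙ T i ^ p))     ≈⟨ -‿cong (Σ-*ˡ (suc e) (c 0) (λ i → E i ∙ T i ^ p)) ⟩
          ⊖ Σ< (suc e) (λ i → c 0 ∙ (E i ∙ T i ^ p))     ≈⟨ Σ-neg (suc e) (λ i → c 0 ∙ (E i ∙ T i ^ p)) ⟩
          Σ< (suc e) (λ i → ⊖ (c 0 ∙ (E i ∙ T i ^ p)))
            ≈⟨ Σ-cong (suc e) {G = λ i → ⊖ (c 0 ∙ E i) ∙ T i ^ p} (λ i _ → trans (-‿cong (sym (*-assoc (c 0) (E i) (T i ^ p)))) (-‿distribˡ-* (c 0 ∙ E i) (T i ^ p))) ⟩
          Σ< (suc e) (λ i → ⊖ (c 0 ∙ E i) ∙ T i ^ p)     ∎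
        right : Σ< e (λ i → lower c i ∙ T i ^ p) ≈ Σ< (suc e) (λ i → lower c i ∙ T i ^ p)
        right = begin
          Σ< e (λ i → lower c i ∙ T i ^ p)                            ≈⟨ +-identityʳ (Σ< e (λ i → lower c i ∙ T i ^ p)) ⟨
          Σ< e (λ i → lower c i ∙ T i ^ p) ⊕ 0#                       ≈⟨ +-congˡ {Σ< e (λ i → lower c i ∙ T i ^ p)} last≈0 ⟨
          Σ< e (λ i → lower c i ∙ T i ^ p) ⊕ lower c e ∙ T e ^ p      ≈⟨ Σ-last e (λ i → lower c i ∙ T i ^ p) ⟨
          Σ< (suc e) (λ i → lower c i ∙ T i ^ p)                      ∎
          where
          last≈0 : lower c e ∙ T e ^ p ≈ 0#
          last≈0 = trans (*-congʳ {T e ^ p} (CommutativeRing.reflexive R (lower-e c))) (zeroˡ (T e ^ p))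

      represents-section : ∀ r → r < p → ∀ {c h} → c represents h → (section r ∘ d c) represents section r h
      represents-section r r<p {c} {h} rep = begin
        A ^ (p ℕ.^ e) ∙ section r h                     ≈⟨ *-comm (A ^ (p ℕ.^ e)) (section r h) ⟩
        section r h ∙ A ^ (p ℕ.^ e)                     ≈⟨ section-⊛^p r r<p h (A ^ (p ℕ.^ e)) ⟨
        section r (h ∙ (A ^ (p ℕ.^ e)) ^ p)             ≈⟨ section-cong r (raise {c} {h} rep) ⟩
        section r (Σ< (suc e) (λ i → d c i ∙ T i ^ p))  ≈⟨ section-relation r r<p (suc e) (d c) T ⟩
        Σ< (suc e) (λ i → section r (d c i) ∙ T i)      ∎

      E-bound : ∃ λ D → ∀ i → i < suc e → Deg< D (E i)
      E-bound = poly-bound (suc e) E λ i →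
        Polynomials.poly-* polynomials (poly-a (suc i)) (poly-^ (p ℕ.^ suc i ℕ.∸ 2) (poly-a 0))

      N : ℕ
      N = proj₁ (poly-a 0) ℕ.⊔ proj₁ E-bound

      Bounded : (ℕ → PS) → Set
      Bounded c = ∀ i → i < suc e → Deg< N (c i)

      -- The product `c 0 ∙ E i` has degree below 2 N, and the section halves this bound. Hence one
      -- N serves for all iterated sections, which is where finiteness comes from.
      bounded-section : ∀ r {c} → Bounded c → Bounded (section r ∘ d c)
      bounded-section r {c} bc i i≤e = deg-section r (d c i)
        (deg-+ {f = lower c i} {⊖ (c 0 ∙ E i)} (deg-mono {f = lower c i} (ℕP.m≤m+n N N) lower-bound)
          (deg-neg {f = c 0 ∙ E i} (deg-* N (c 0) (E i) (bc 0 z<s)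
            (deg-mono {f = E i} (ℕP.m≤n⊔m (proj₁ (poly-a 0)) (proj₁ E-bound)) (proj₂ E-bound i i≤e)))))
        where
        lower-bound : Deg< N (lower c i)
        lower-bound with i ℕP.<? e
        ... | yes i<e = bc (suc i) (s<s i<e)
        ... | no  _   = λ _ _ → reflexive ≡.refl

      initial : ℕ → PS
      -- This encodes f = A g.
      initial zero    = A
      initial (suc _) = 0#

      initial-bounded : Bounded initial
      initial-bounded zero    _ = deg-mono {f = A} (ℕP.m≤m⊔n (proj₁ (poly-a 0)) (proj₁ E-bound)) (proj₂ (poly-a 0))
      initial-bounded (suc i) _ = λ _ _ → reflexive ≡.refl

      initial-represents : initial represents f
      initial-represents = sym (begin
        A ∙ T 0 ⊕ Σ< e (λ i → 0# ∙ T (suc i))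
          ≈⟨ +-cong (*-congˡ {A} (*-congˡ {A ^ (p ℕ.^ e ℕ.∸ 1)} (*-identityʳ f))) (Σ-zero e (λ i _ → zeroˡ (T (suc i)))) ⟩
        A ∙ (A ^ (p ℕ.^ e ℕ.∸ 1) ∙ f) ⊕ 0#          ≈⟨ +-identityʳ (A ∙ (A ^ (p ℕ.^ e ℕ.∸ 1) ∙ f)) ⟩
        A ∙ (A ^ (p ℕ.^ e ℕ.∸ 1) ∙ f)               ≈⟨ *-assoc A (A ^ (p ℕ.^ e ℕ.∸ 1)) f ⟨
        A ^ suc (p ℕ.^ e ℕ.∸ 1) ∙ f                 ≈⟨ *-congʳ {f} (^-congʳ A (ℕP.m+[n∸m]≡n (ℕP.m^n>0 p e))) ⟩
        A ^ (p ℕ.^ e) ∙ f                           ∎)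

      Representable : PS → Set
      Representable h = ∃ λ (c : ℕ → PS) → c represents h × Bounded c

      representable-cong : ∀ {g h} → (∀ n → h n ≡ g n) → Representable g → Representable h
      representable-cong h≡g (c , rep , bc) = c , trans (*-congˡ {A ^ (p ℕ.^ e)} (exact h≡g)) rep , bc

      representable-section : ∀ r → r < p → ∀ {h} → Representable h → Representable (section r h)
      representable-section r r<p {h} (c , rep , bc) =
        section r ∘ d c , represents-section r r<p {c} {h} rep , bounded-section r {c} bc

      -- The lowest base-p digit of r is handled by one section and the remaining digits by
      -- induction, which is why h is arbitrary here.
      representable-kernel : ∀ l r → r < p ℕ.^ l → ∀ {h} → Representable h →
                             Representable (λ n → h (p ℕ.^ l ℕ.* n ℕ.+ r))
      representable-kernel zero zero _ {h} =
        representable-cong λ n → cong h (≡.trans (ℕP.+-identityʳ _) (ℕP.*-identityˡ n))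
      representable-kernel zero (suc r) (s≤s ())
      representable-kernel (suc l) r r< {h} rep = representable-cong same
        (representable-kernel l (r ℕ./ p) (m<n*o⇒m/o<n (subst (r <_) (ℕP.*-comm p (p ℕ.^ l)) r<))
          {section (r ℕ.% p) h} (representable-section (r ℕ.% p) (m%n<n r p) {h} rep))
        where
        open import Data.Nat.DivMod using (m<n*o⇒m/o<n; m%n<n; m≡m%n+[m/n]*n)
        open import Data.Nat.Tactic.RingSolver using (solve-∀)
        regroup : ∀ p q n x y → p ℕ.* q ℕ.* n ℕ.+ (x ℕ.+ y ℕ.* p) ≡ p ℕ.* (q ℕ.* n ℕ.+ y) ℕ.+ x
        regroup = solve-∀
        same : ∀ n → h (p ℕ.^ suc l ℕ.* n ℕ.+ r) ≡ section (r ℕ.% p) h (p ℕ.^ l ℕ.* n ℕ.+ r ℕ./ p)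
        same n = cong h (≡.trans (cong (p ℕ.^ suc l ℕ.* n ℕ.+_) (m≡m%n+[m/n]*n r p))
          (regroup p (p ℕ.^ l) n (r ℕ.% p) (r ℕ./ p)))

      -- Equal coefficients give equal products with A^(p^e), and this nonzero factor cancels.
      represents-injective : ∀ {c c′ h h′} → (∀ i → i < suc e → c i ≈ c′ i) →
                             c represents h → c′ represents h′ → h ≈ h′
      represents-injective {c} {c′} {h} {h′} c≈c′ rep rep′ =
        trans (inverseˡ-unique h (⊖ h′) (⊛-cancel (proj₁ A^≉0) M (h ⊕ ⊖ h′) (proj₂ A^≉0) (begin
          M ∙ (h ⊕ ⊖ h′)              ≈⟨ distribˡ M h (⊖ h′) ⟩
          M ∙ h ⊕ M ∙ (⊖ h′)          ≈⟨ +-cong agree (sym (-‿distribʳ-* M h′)) ⟩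
          M ∙ h′ ⊕ ⊖ (M ∙ h′)         ≈⟨ -‿inverseʳ (M ∙ h′) ⟩
          0#                          ∎)))
          (exact λ n → ℤP.neg-involutive (h′ n))
        where
        M = A ^ (p ℕ.^ e)
        A^≉0 : NonZero M
        A^≉0 = nonZ-^ (p ℕ.^ e) A≉0
        agree : M ∙ h ≈ M ∙ h′
        agree = trans rep (trans (Σ-cong (suc e) {G = λ i → c′ i ∙ T i} (λ i i<n → *-congʳ {T i} (c≈c′ i i<n))) (sym rep′))

      representation : ∀ l r → r < p ℕ.^ l → Representable (λ n → f (p ℕ.^ l ℕ.* n ℕ.+ r))
      representation l r r< = representable-kernel l r r< {f} (initial , initial-represents , initial-bounded)

      kernel-class : ∀ l r → r < p ℕ.^ l → Fin ((p ℕ.^ N) ℕ.^ suc e)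
      kernel-class l r r< = code (suc e) N (proj₁ (representation l r r<))

      kernel-class-sound : ∀ l r l′ r′ (r< : r < p ℕ.^ l) (r′< : r′ < p ℕ.^ l′) →
        kernel-class l r r< ≡ kernel-class l′ r′ r′< →
        ∀ n → Congruent p (f (p ℕ.^ l ℕ.* n ℕ.+ r)) (f (p ℕ.^ l′ ℕ.* n ℕ.+ r′))
      kernel-class-sound l r l′ r′ r< r′< eq =
        separate {λ n → f (p ℕ.^ l ℕ.* n ℕ.+ r)} {λ n → f (p ℕ.^ l′ ℕ.* n ℕ.+ r′)}
          (representation l r r<) (representation l′ r′ r′<) eq
        where
        separate : ∀ {g h} (G : Representable g) (H : Representable h) →
                   code (suc e) N (proj₁ G) ≡ code (suc e) N (proj₁ H) → ∀ n → Congruent p (g n) (h n)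
        separate {g} {h} (c , rep , bc) (c′ , rep′ , bc′) eq =
          at (represents-injective {c} {c′} {g} {h} (code-injective (suc e) N {c} {c′} bc bc′ eq) rep rep′)

    -- Finiteness is expressed by a classifying map, not by a list of sequences: it is not decided
    -- which coefficient tuples actually occur, so no representatives can be listed yet.
    FiniteKernelMod : PS → Set
    FiniteKernelMod f = ∃₂ λ M (class : ∀ l r → r < p ℕ.^ l → Fin M) →
      ∀ l r l′ r′ (r< : r < p ℕ.^ l) (r′< : r′ < p ℕ.^ l′) → class l r r< ≡ class l′ r′ r′< →
      ∀ n → Congruent p (f (p ℕ.^ l ℕ.* n ℕ.+ r)) (f (p ℕ.^ l′ ℕ.* n ℕ.+ r′))

    relation⇒finite-kernel : ∀ {f m a} → Relation f (p ℕ.^_) m a → FiniteKernelMod f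
    relation⇒finite-kernel {f} {m} {a} rel with separable-relation f m a rel
    ... | suc e , b , poly-b , b0≉0 , rel′ = (p ℕ.^ N) ℕ.^ suc e , kernel-class , kernel-class-sound
      where open Closure f e b poly-b b0≉0 rel′
    -- The relation has the single term b 0 · f, so f vanishes modulo p and one class is enough.
    ... | zero , b , poly-b , b0≉0 , rel′ = 1 , (λ _ _ _ → Fin.zero) , λ _ _ _ _ _ _ _ n → ≈-trans (at f≈0 _) (≈-sym (at f≈0 _))
      where
      f≈0 : f ≈ 0#
      f≈0 = ⊛-cancel (proj₁ b0≉0) (b 0) f (proj₂ b0≉0) (begin
        b 0 ∙ f                   ≈⟨ *-congˡ {b 0} (*-identityʳ f) ⟨
        b 0 ∙ f ^ 1               ≈⟨ +-identityʳ (b 0 ∙ f ^ 1) ⟨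
        b 0 ∙ f ^ 1 ⊕ 0#          ≈⟨ rel′ ⟩
        0#                        ∎)

    polyPS-poly : ∀ as → Poly (polyPS as)
    polyPS-poly as = length as , deg as
      where
      open import Data.List using (List; []; _∷_; length)
      deg : ∀ as → Deg< (length as) (polyPS as)
      deg []       n       _         = reflexive ≡.refl
      deg (a ∷ as) (suc n) (s≤s len≤n) = deg as n len≤n

    ^ₚ≈^ : ∀ f j → f ^ₚ j ≈ f ^ j
    ^ₚ≈^ f zero    = exact λ { zero → ≡.refl ; (suc _) → ≡.refl }
    ^ₚ≈^ f (suc j) = *-congˡ {f} (^ₚ≈^ f j)

    sumFin≈Σ< : ∀ n (F : Fin n → PS) (G : ℕ → PS) → (∀ i → F i ≈ G (toℕ i)) →
                ∀ k → Congruent p (sumFin n (λ i → F i k)) (Σ< n G k)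
    sumFin≈Σ< zero    F G F≈G k = reflexive ≡.refl
    sumFin≈Σ< (suc n) F G F≈G k =
      +-cong-mod (at (F≈G Fin.zero) k) (sumFin≈Σ< n (F ∘ Fin.suc) (G ∘ suc) (F≈G ∘ Fin.suc) k)

    extend : ∀ n → (Fin n → PS) → ℕ → PS
    extend zero    P _       = 0#
    extend (suc n) P zero    = P Fin.zero
    extend (suc n) P (suc i) = extend n (P ∘ Fin.suc) i

    extend-toℕ : ∀ n P i → extend n P (toℕ i) ≡ P i
    extend-toℕ (suc n) P Fin.zero    = ≡.refl
    extend-toℕ (suc n) P (Fin.suc i) = extend-toℕ n (P ∘ Fin.suc) i

    extend-poly : ∀ n P → (∀ i → Poly (P i)) → ∀ i → Poly (extend n P i)
    extend-poly zero    P pP _       = 0 , λ _ _ → reflexive ≡.refl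
    extend-poly (suc n) P pP zero    = pP Fin.zero
    extend-poly (suc n) P pP (suc i) = extend-poly n (P ∘ Fin.suc) (pP ∘ Fin.suc) i

    -- The given relation in consecutive powers of f is traded for one in the powers f^(p^i), the
    -- form that sections preserve.
    christol : ∀ {f} → AlgebraicMod p f → FiniteKernelMod f
    christol {f} (d , P , (i , n , Pin≉0) , root) =
      relation⇒finite-kernel {f} (proj₂ (proj₂ (powers-dependent f {suc d} {Q}
        (extend-poly (suc d) (polyPS ∘ P) (polyPS-poly ∘ P) , (toℕ i , Fin.toℕ<n i , n , Qin≉0) , pw vanish) (p ℕ.^_))))
      where
      Q : ℕ → PS
      Q = extend (suc d) (polyPS ∘ P)
      Qin≉0 : ¬ Zero (Q (toℕ i) n)
      Qin≉0 z = Pin≉0 (zero⇒∣ (subst (λ g → Zero (g n)) (extend-toℕ (suc d) (polyPS ∘ P) i) z))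
      term : ∀ j → polyPS (P j) ∙ f ^ₚ toℕ j ≈ Q (toℕ j) ∙ f ^ toℕ j
      term j = *-cong (CommutativeRing.reflexive R (≡.sym (extend-toℕ (suc d) (polyPS ∘ P) j))) (^ₚ≈^ f (toℕ j))
      vanish : ∀ k → Zero (Σ< (suc d) (λ j → Q j ∙ f ^ j) k)
      vanish k = ≈-trans (≈-sym (sumFin≈Σ< (suc d) (λ j → polyPS (P j) ∙ f ^ₚ toℕ j) (λ j → Q j ∙ f ^ j) term k))
        (∣⇒zero (root k))

-- From congruence classes to automaticity, and the conclusion.

open import Defs
open LiouvilleFunction using (IsSign; liouville-sign)
open PowerSeries using (Congruent; mod)
open AnyBase using (liouville-not-automatic)
open Sections using (christol; FiniteKernelMod)
open import Data.Nat using (ℕ; zero; suc; _+_; _*_; _^_; _<_; _≤_; z≤n; s≤s; >-nonZero)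
open import Data.Nat.Properties
open import Data.Nat.Divisibility using (∣⇒≤)
open import Data.Nat.Primality using (Prime; prime⇒nonZero)
open import Data.Integer as ℤ using (ℤ)
import Data.Integer.Divisibility.Signed as Signed
open import Data.Fin as Fin using (Fin)
open import Data.List using (tabulate)
open import Data.List.Relation.Unary.Any.Properties using (tabulate⁺)
open import Data.Product using (∃; ∃₂; _×_; _,_; proj₁; proj₂)
open import Data.Sum using (inj₁; inj₂)
open import Function using (_∘_)
open import Relation.Nullary using (¬_; Dec; yes; no; contradiction)
open import Relation.Nullary.Decidable using (¬¬-excluded-middle)
open import Relation.Binary.PropositionalEquality

-- Double-negation shift over a finite index set: inside a refutation, finitely many undecidable
-- questions may be assumed answered at once.
¬¬-Fin : ∀ {n} {P : Fin n → Set} → (∀ i → ¬ ¬ P i) → ¬ ¬ (∀ i → P i)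
¬¬-Fin {zero}  h k = k λ ()
¬¬-Fin {suc n} h k = h Fin.zero λ p₀ → ¬¬-Fin (h ∘ Fin.suc) λ ps →
  k λ { Fin.zero → p₀ ; (Fin.suc i) → ps i }

-- The two signs differ by 2, which is not a multiple of p > 2.
signs-congruent : ∀ {p x y} → 2 < p → IsSign x → IsSign y → Congruent p x y → x ≡ y
signs-congruent 2<p (inj₁ refl) (inj₁ refl) _       = refl
signs-congruent 2<p (inj₂ refl) (inj₂ refl) _       = refl
signs-congruent 2<p (inj₁ refl) (inj₂ refl) (mod d) = contradiction (∣⇒≤ (Signed.∣⇒∣ᵤ d)) (<⇒≱ 2<p)
signs-congruent 2<p (inj₂ refl) (inj₁ refl) (mod d) = contradiction (∣⇒≤ (Signed.∣⇒∣ᵤ d)) (<⇒≱ 2<p)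

-- Whether a class is inhabited is not decidable, hence the double negation.
finite-kernel⇒automatic : ∀ {p} (pr : Prime p) → 2 < p →
  FiniteKernelMod pr liouville → ¬ ¬ Automatic p liouville
finite-kernel⇒automatic {p} pr 2<p (M , class , sound) not-automatic =
  ¬¬-Fin (λ c → ¬¬-excluded-middle) λ inhabited? → not-automatic (automatic inhabited?)
  where
  Member : Fin M → Set
  Member c = ∃₂ λ l r → ∃ λ r< → class l r r< ≡ c

  representative : ∀ {c} → Dec (Member c) → ℕ → ℤ
  representative (yes (l , r , _)) = kernelSeq p liouville l r
  -- An empty class has no kernel sequence to match, so its list entry is only a placeholder.
  representative (no _)            = λ _ → ℤ.+ 0

  positive : ∀ l r i → IsSign (kernelSeq p liouville l r i)
  positive l r i = liouville-sign _ {{>-nonZero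
    (≤-trans (*-mono-≤ (m^n>0 p {{prime⇒nonZero pr}} l) (s≤s (z≤n {i}))) (m≤m+n _ r))}}

  represents : ∀ l r r< (member? : Dec (Member (class l r r<))) →
               ∀ i → representative member? i ≡ kernelSeq p liouville l r i
  represents l r r< (no  none)                i = contradiction (l , r , r< , refl) none
  represents l r r< (yes (l′ , r′ , r′< , eq)) i = signs-congruent 2<p (positive l′ r′ i) (positive l r i)
    -- Index i of a kernel sequence stands for n = i + 1.
    (sound l′ r′ l r r′< r< eq (suc i))

  automatic : (∀ c → Dec (Member c)) → Automatic p liouville
  automatic member? = tabulate (λ c → representative (member? c)) ,
    λ l r r< → tabulate⁺ (class l r r<) (represents l r r< (member? (class l r r<)))

theorem1p5 : (∀ (k : ℕ) → 2 ≤ k → ¬ Automatic k liouville)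
    × (∀ (p : ℕ) → Prime p → 2 < p → TranscendentalMod p liouville)
theorem1p5 = liouville-not-automatic , λ p pr 2<p algebraic →
  finite-kernel⇒automatic pr 2<p (christol pr algebraic) (liouville-not-automatic p (<⇒≤ 2<p))
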